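{- Let $m\ge 2$ be a fixed integer. There is a constant $\varepsilon>0$ such that every (possibly adaptive, two-sided error) $\varepsilon$-tester for the problem $D_m$-membership$(n)$ requires $\Omega(n^{1/5})$ queries.
   Context: $D_m$ is the Dyck language of properly balanced strings of parentheses of $m$ types. $D_m$-membership$(n)$: given a string of even length $n$ over the alphabet of parentheses of $m$ types, decide whether it is in $D_m$. Two strings of length $n$ are $\varepsilon$-close if their Hamming distance is at most $\varepsilon n$, and $\varepsilon$-far otherwise. A randomized algorithm is an $\varepsilon$-tester for a language $L$ if it accepts every input in $L$ with probability at least $2/3$ and rejects every input that is $\varepsilon$-far from all members of $L$ with probability at least $2/3$. The algorithm knows the input length and accesses the input only by querying single characters; the number of queries is measured in the worst case. -}

module Defs where

open import Data.Bool.Base using (Bool; true; false; if_then_else_)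
open import Data.Fin.Base using (Fin; zero; suc)
import Data.Fin.Properties as Fin
open import Data.Integer.Base using (+_)
open import Data.List.Base using (List; []; _∷_; _++_; [_])
open import Data.Nat.Base as ℕ using (ℕ; zero; suc)
open import Data.Product.Base using (_×_; _,_; ∃-syntax)
open import Data.Rational.Base as ℚ using (ℚ; 0ℚ; 1ℚ; ½; ∣_∣)
import Data.Nat.Properties as ℕ
import Data.Rational.Properties as ℚ
import Data.Rational.Solver as ℚ
open import Data.Vec.Base using (Vec; []; _∷_; lookup; toList)
open import Relation.Binary.Definitions using (DecidableEquality)
open import Relation.Binary.PropositionalEquality
  using (_≡_; refl; sym; cong; subst)
open import Relation.Nullary using (¬_; does; yes; no)
import Relation.Nullary.Decidable as Dec

-- Real numbers as Cauchy sequences of rationals.  No rate of convergence is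
-- prescribed, so addition can be taken pointwise.

record ℝ : Set where
  constructor mkℝ
  field
    seq    : ℕ → ℚ
    cauchy : ∀ δ → 0ℚ ℚ.< δ →
             ∃[ N ] (∀ i j → N ℕ.≤ i → N ℕ.≤ j → ∣ seq i ℚ.- seq j ∣ ℚ.≤ δ)

open ℝ public

fromℚ : ℚ → ℝ
fromℚ p = mkℝ (λ _ → p) λ δ 0<δ → 0 , λ _ _ _ _ →
  subst (λ r → ∣ r ∣ ℚ.≤ δ) (sym (ℚ.+-inverseʳ p)) (ℚ.<⇒≤ 0<δ)

0ℝ 1ℝ ⅔ : ℝ
0ℝ = fromℚ 0ℚ
1ℝ = fromℚ 1ℚ
⅔  = fromℚ (+ 2 ℚ./ 3)

infixl 6 _+ℝ_

_+ℝ_ : ℝ → ℝ → ℝ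
x +ℝ y = mkℝ (λ i → seq x i ℚ.+ seq y i) λ δ 0<δ →
  let 0<½δ      = ℚ.*-monoʳ-<-pos ½ 0<δ
      (M , x-M) = cauchy x (½ ℚ.* δ) 0<½δ
      (N , y-N) = cauchy y (½ ℚ.* δ) 0<½δ
  in M ℕ.⊔ N , λ i j ≤i ≤j → begin
    ∣ (seq x i ℚ.+ seq y i) ℚ.- (seq x j ℚ.+ seq y j) ∣
      ≡⟨ cong ∣_∣ (regroup (seq x i) (seq y i) (seq x j) (seq y j)) ⟩
    ∣ (seq x i ℚ.- seq x j) ℚ.+ (seq y i ℚ.- seq y j) ∣
      ≤⟨ ℚ.∣p+q∣≤∣p∣+∣q∣ (seq x i ℚ.- seq x j) (seq y i ℚ.- seq y j) ⟩
    ∣ seq x i ℚ.- seq x j ∣ ℚ.+ ∣ seq y i ℚ.- seq y j ∣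
      ≤⟨ ℚ.+-mono-≤
           (x-M i j (ℕ.m⊔n≤o⇒m≤o M N ≤i) (ℕ.m⊔n≤o⇒m≤o M N ≤j))
           (y-N i j (ℕ.m⊔n≤o⇒n≤o M N ≤i) (ℕ.m⊔n≤o⇒n≤o M N ≤j)) ⟩
    ½ ℚ.* δ ℚ.+ ½ ℚ.* δ
      ≡⟨ halves δ ⟩
    δ ∎
  where
  open ℚ.≤-Reasoning
  open ℚ.+-*-Solver

  regroup : ∀ a b c d →
    (a ℚ.+ b) ℚ.- (c ℚ.+ d) ≡ (a ℚ.- c) ℚ.+ (b ℚ.- d)
  regroup = solve 4
    (λ a b c d → (a :+ b) :+ :- (c :+ d) := (a :+ :- c) :+ (b :+ :- d)) refl

  halves : ∀ d → ½ ℚ.* d ℚ.+ ½ ℚ.* d ≡ d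
  halves = solve 1 (λ d → con ½ :* d :+ con ½ :* d := d) refl

infix 4 _≤ℝ_ _≃ℝ_

_≤ℝ_ : ℝ → ℝ → Set
x ≤ℝ y = ∀ δ → 0ℚ ℚ.< δ →
         ∃[ N ] (∀ i → N ℕ.≤ i → seq x i ℚ.≤ seq y i ℚ.+ δ)

_≃ℝ_ : ℝ → ℝ → Set
x ≃ℝ y = x ≤ℝ y × y ≤ℝ x

∑ : ∀ {k} → (Fin k → ℝ) → ℝ
∑ {zero}  f = 0ℝ
∑ {suc k} f = f zero +ℝ ∑ (λ i → f (suc i))

data Paren (m : ℕ) : Set where
  opening closing : Fin m → Paren m

data Dyck {m : ℕ} : List (Paren m) → Set where
  empty  : Dyck []
  wrap   : ∀ {u} (t : Fin m) → Dyck u → Dyck (opening t ∷ u ++ [ closing t ])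
  concat : ∀ {u v} → Dyck u → Dyck v → Dyck (u ++ v)

DyckWord : ∀ m {n} → Vec (Paren m) n → Set
DyckWord m w = Dyck (toList w)

infix 4 _≟_

_≟_ : ∀ {m} → DecidableEquality (Paren m)
opening s ≟ opening t = Dec.map′ (cong opening) (λ { refl → refl }) (s Fin.≟ t)
opening s ≟ closing t = no λ ()
closing s ≟ opening t = no λ ()
closing s ≟ closing t = Dec.map′ (cong closing) (λ { refl → refl }) (s Fin.≟ t)

hamming : ∀ {m n} → Vec (Paren m) n → Vec (Paren m) n → ℕ
hamming []       []       = 0
hamming (a ∷ as) (b ∷ bs) =
  (if does (a ≟ b) then 0 else 1) ℕ.+ hamming as bs

Close : ∀ {m n} → ℚ → Vec (Paren m) n → Vec (Paren m) n → Set
Close {n = n} ε x y = (+ hamming x y ℚ./ 1) ℚ.≤ ε ℚ.* (+ n ℚ./ 1)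

Far : ∀ {m n} → ℚ → Vec (Paren m) n → Vec (Paren m) n → Set
Far ε x y = ¬ Close ε x y

-- Deterministic adaptive algorithms on inputs in Aⁿ that make at most q
-- queries on every input: the answer to a query selects the continuation.

data Algorithm (A : Set) (n : ℕ) : ℕ → Set where
  output : ∀ {q} → Bool → Algorithm A n q
  query  : ∀ {q} → Fin n → (A → Algorithm A n q) → Algorithm A n (suc q)

run : ∀ {A n q} → Algorithm A n q → Vec A n → Bool
run (output b)  x = b
run (query i k) x = run (k (lookup x i)) x

-- A randomized algorithm is a probability distribution on deterministic ones.
-- Over a finite alphabet there are only finitely many of the latter for given
-- n and q, so finite support is no restriction.

record RandomizedAlgorithm (A : Set) (n q : ℕ) : Set where
  field
    size      : ℕ
    algorithm : Fin size → Algorithm A n q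
    weight    : Fin size → ℝ
    weight≥0  : ∀ i → 0ℝ ≤ℝ weight i
    ∑weight≃1 : ∑ weight ≃ℝ 1ℝ

open RandomizedAlgorithm public

Pr[_on_accepts] Pr[_on_rejects] :
  ∀ {A n q} → RandomizedAlgorithm A n q → Vec A n → ℝ
Pr[ T on x accepts] =
  ∑ λ i → if run (algorithm T i) x then weight T i else 0ℝ
Pr[ T on x rejects] =
  ∑ λ i → if run (algorithm T i) x then 0ℝ else weight T i

record IsTester {m n q} (ε : ℚ) (L : Vec (Paren m) n → Set)
                (T : RandomizedAlgorithm (Paren m) n q) : Set where
  field
    accepts : ∀ x → L x → ⅔ ≤ℝ Pr[ T on x accepts]
    rejects : ∀ x → (∀ y → L y → Far ε x y) → ⅔ ≤ℝ Pr[ T on x rejects]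

-- f(n) = Ω(n^{1/5}) as "C · f(n) ≥ n^{1/5} for all large n", both sides raised
-- to the fifth power; the implied constant is 1/C.

FifthRootBound : (C n q : ℕ) → Set
FifthRootBound C n q = n ℕ.≤ (C ℕ.* q) ℕ.^ 5

{-# OPTIONS --safe #-}
module Submission where

-- A word is built from K random types: K opening parentheses, then padding (),
-- then a long run of closing parentheses, then padding again.  The closing run is
-- slightly too short; the missing 2r closing parentheses that precede it and the
-- 2(R − r) that follow it are hidden in the a-th of L segments of either padding.
-- If the closing types repeat the opening types the word is Dyck; if they are
-- chosen independently it is far from Dyck with high probability.  As long as no
-- query falls into segment a and no two queries hit parentheses that match each
-- other, the answers are independent coins in both cases.  For random (a , r) this
-- fails with probability at most q/L + q²/R, so that q queries do not suffice when
-- L and R are large multiples of q and q²; the length needed for that is O(q³).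
--
-- For farness, sum E^(number of agreements) over all Dyck words.  Reading a word
-- against a stack, a closing parenthesis has one admissible type, so a random
-- closing type agrees with it half of the time at best: every position of the run
-- costs a factor of about 2 in the expected sum.

open import Data.Bool.Base using (Bool; true; false; if_then_else_; not)
open import Data.Empty using (⊥)
open import Data.Fin.Base
  using (Fin; zero; suc; toℕ; fromℕ<; _↑ˡ_; _↑ʳ_; splitAt; remQuot; combine)
import Data.Fin.Properties as Fin
open import Data.Integer.Base as ℤ using (-[1+_]) renaming (+_ to pos)
import Data.Integer.Properties as ℤ
open import Data.List.Base as List using (List; []; _∷_; length; _++_; [_]; applyUpTo)
open import Data.List.Properties
  using (++-assoc; ++-identityʳ; applyUpTo-∷ʳ; ∷ʳ-++; tabulate-cong)
open import Data.Maybe.Base using (Maybe; just; nothing)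
open import Data.Nat.Base
open import Data.Nat.Coprimality using (1-coprimeTo)
open import Data.Nat.Divisibility using (_∣_; divides)
open import Data.Nat.DivMod using (m/n*n≤m; m%n<n; m≡m%n+[m/n]*n)
open import Data.Nat.Properties hiding (_≟_)
import Data.Nat.Properties as ℕ
open import Data.Nat.Solver using (module +-*-Solver)
open import Data.Product.Base
  using (_×_; _,_; ∃-syntax; Σ-syntax; proj₁; proj₂; map₁; uncurry)
open import Data.Rational.Base as ℚ using (ℚ; 0ℚ; 1ℚ; mkℚ; toℚᵘ)
import Data.Rational.Properties as ℚ
import Data.Rational.Solver as ℚ
open import Data.Rational.Unnormalised.Base as ℚᵘ using (mkℚᵘ; *≡*; *≤*)
import Data.Rational.Unnormalised.Properties as ℚᵘ
open import Data.Sum.Base using (inj₁; inj₂; [_,_]′)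
open import Data.Unit.Base using (⊤; tt)
open import Data.Vec.Base using (Vec; []; _∷_; lookup; tabulate; toList; _[_]≔_)
open import Data.Vec.Properties
  using (lookup∘updateAt; lookup∘updateAt′; []≔-commutes; lookup∘tabulate)
open import Function.Base using (_∘_; id)
open import Relation.Binary.PropositionalEquality hiding ([_])
open import Relation.Nullary using (Dec; yes; no; ¬_; contradiction; does)
open import Relation.Nullary.Decidable using (dec-true; dec-false; from-yes)
open import Defs

open +-*-Solver using (solve; con; _:+_; _:*_; _:=_; _:^_)
open ℚ.+-*-Solver using () renaming
  (solve to solveℚ; con to conℚ; _:+_ to _⊕_; _:*_ to _⊛_; :-_ to ⊝_; _:=_ to _⊜_)

-- Finite sums

-- The shift `r` exists because a fixed pairing could be tested with two queries; once the run
-- starts at closing number 2r, two given positions match for at most one of the R shifts. A bare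
-- shift would show at the ends of the run, hence the hidden segments that make up for it. Farness
-- must hold against exponentially many Dyck words and all their Hamming balls. The sum over Dyck
-- words treats them together: a Dyck word at distance h from the input contributes E^(n-h), whereas
-- the expected sum is at most 2^(-M) (E+2m+1)^n, with M the length of the long closing run. With E
-- = 64(2m+1) the factor (1+1/64)^n costs about 2^(n/32), and with ε = 1/(32E) the factor E^h costs
-- at most 2^(n/32). Since M is at least n/8, the gain 2^(-M) prevails. All probabilities are counts
-- over one sample space, shapes (a, r) times n coins. A tester has real weights, known only
-- approximately; replacing them by naturals lowers the threshold 2/3 to 5/8, which the argument can
-- afford.

record Summation (A : Set) : Set where
  field
    total      : (A → ℕ) → ℕ
    total-mono : ∀ {f g} → (∀ a → f a ≤ g a) → total f ≤ total g
    total-+    : ∀ f g → total (λ a → f a + g a) ≡ total f + total g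

  -- A finite distribution left unnormalised: the probability of an event is its `total` against
  -- `mass`, so the two families are compared within the naturals.
  mass : ℕ
  mass = total λ _ → 1

  total-cong : ∀ {f g} → (∀ a → f a ≡ g a) → total f ≡ total g
  total-cong f≗g =
    ≤-antisym (total-mono (≤-reflexive ∘ f≗g)) (total-mono (≤-reflexive ∘ sym ∘ f≗g))

  total-0 : total (λ _ → 0) ≡ 0
  total-0 = +-cancelˡ-≡ (total λ _ → 0) _ _
    (trans (sym (total-+ (λ _ → 0) λ _ → 0)) (sym (+-identityʳ _)))

  total-*ˡ : ∀ k f → total (λ a → k * f a) ≡ k * total f
  total-*ˡ zero    f = total-0
  total-*ˡ (suc k) f =
    trans (total-+ f _) (cong (total f +_) (total-*ˡ k f))

  total-*ʳ : ∀ f k → total (λ a → f a * k) ≡ total f * k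
  total-*ʳ f k = begin
    total (λ a → f a * k) ≡⟨ total-cong (λ a → *-comm (f a) k) ⟩
    total (λ a → k * f a) ≡⟨ total-*ˡ k f ⟩
    k * total f           ≡⟨ *-comm k _ ⟩
    total f * k           ∎
    where open ≡-Reasoning

  total-const : ∀ k → total (λ _ → k) ≡ k * mass
  total-const k = trans (total-cong λ _ → sym (*-identityʳ k)) (total-*ˡ k _)

open Summation public

∑ᶠ : ∀ {k} → (Fin k → ℕ) → ℕ
∑ᶠ {zero}  f = 0
∑ᶠ {suc k} f = f zero + ∑ᶠ (f ∘ suc)

+-interchange : ∀ a b c d → (a + b) + (c + d) ≡ (a + c) + (b + d)
+-interchange = solve 4 (λ a b c d → (a :+ b) :+ (c :+ d) := (a :+ c) :+ (b :+ d)) refl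

finSum : ∀ k → Summation (Fin k)
finSum k = record { total = ∑ᶠ ; total-mono = mono ; total-+ = add }
  where
  mono : ∀ {k} {f g : Fin k → ℕ} → (∀ i → f i ≤ g i) → ∑ᶠ f ≤ ∑ᶠ g
  mono {zero}  f≤g = z≤n
  mono {suc k} f≤g = +-mono-≤ (f≤g zero) (mono (f≤g ∘ suc))

  add : ∀ {k} (f g : Fin k → ℕ) → ∑ᶠ (λ i → f i + g i) ≡ ∑ᶠ f + ∑ᶠ g
  add {zero}  f g = refl
  add {suc k} f g = trans (cong (f zero + g zero +_) (add (f ∘ suc) (g ∘ suc)))
    (+-interchange (f zero) (g zero) _ _)

mass-finSum : ∀ k → mass (finSum k) ≡ k
mass-finSum zero    = refl
mass-finSum (suc k) = cong suc (mass-finSum k)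

∑ᵇ : ∀ {n} → (Vec Bool n → ℕ) → ℕ
∑ᵇ {zero}  f = f []
∑ᵇ {suc n} f = ∑ᵇ (f ∘ (false ∷_)) + ∑ᵇ (f ∘ (true ∷_))

bitSum : ∀ n → Summation (Vec Bool n)
bitSum n = record { total = ∑ᵇ ; total-mono = mono ; total-+ = add }
  where
  mono : ∀ {n} {f g : Vec Bool n → ℕ} → (∀ w → f w ≤ g w) → ∑ᵇ f ≤ ∑ᵇ g
  mono {zero}  f≤g = f≤g []
  mono {suc n} f≤g = +-mono-≤ (mono (f≤g ∘ (false ∷_))) (mono (f≤g ∘ (true ∷_)))

  add : ∀ {n} (f g : Vec Bool n → ℕ) → ∑ᵇ (λ w → f w + g w) ≡ ∑ᵇ f + ∑ᵇ g
  add {zero}  f g = refl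
  add {suc n} f g = trans
    (cong₂ _+_ (add (f ∘ (false ∷_)) (g ∘ (false ∷_)))
               (add (f ∘ (true ∷_)) (g ∘ (true ∷_))))
    (+-interchange (∑ᵇ (f ∘ (false ∷_))) (∑ᵇ (g ∘ (false ∷_))) _ _)

mass-bitSum : ∀ n → mass (bitSum n) ≡ 2 ^ n
mass-bitSum zero    = refl
mass-bitSum (suc n) = cong₂ _+_ (mass-bitSum n)
  (trans (mass-bitSum n) (sym (+-identityʳ _)))

-- Every word arises twice on the right, once from each value of the overwritten coin. Overwriting
-- instead of removing the coin keeps the sample space fixed while queries are answered.
∑ᵇ-[]≔ : ∀ {n} (v : Fin n) (f : Vec Bool n → ℕ) →
  2 * ∑ᵇ f ≡ ∑ᵇ (λ w → f (w [ v ]≔ false)) + ∑ᵇ (λ w → f (w [ v ]≔ true))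
∑ᵇ-[]≔ {suc n} zero f =
  solve 2 (λ a b → con 2 :* (a :+ b) := (a :+ a) :+ (b :+ b)) refl
    (∑ᵇ (f ∘ (false ∷_))) (∑ᵇ (f ∘ (true ∷_)))
∑ᵇ-[]≔ {suc n} (suc v) f = begin
  2 * (∑ᵇ (f ∘ (false ∷_)) + ∑ᵇ (f ∘ (true ∷_)))
    ≡⟨ *-distribˡ-+ 2 (∑ᵇ (f ∘ (false ∷_))) _ ⟩
  2 * ∑ᵇ (f ∘ (false ∷_)) + 2 * ∑ᵇ (f ∘ (true ∷_))
    ≡⟨ cong₂ _+_ (∑ᵇ-[]≔ v (f ∘ (false ∷_))) (∑ᵇ-[]≔ v (f ∘ (true ∷_))) ⟩
  _ ≡⟨ +-interchange (∑ᵇ λ w → f (false ∷ w [ v ]≔ false)) _ _ _ ⟩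
  _ ∎
  where open ≡-Reasoning

infixr 3 _⊗_

_⊗_ : ∀ {A B} → Summation A → Summation B → Summation (A × B)
S ⊗ T = record
  { total      = λ f → total S λ a → total T λ b → f (a , b)
  ; total-mono = λ f≤g → total-mono S λ a → total-mono T λ b → f≤g (a , b)
  ; total-+    = λ f g → trans (total-cong S λ a → total-+ T _ _) (total-+ S _ _)
  }

mass-⊗ : ∀ {A B} (S : Summation A) (T : Summation B) → mass (S ⊗ T) ≡ mass S * mass T
mass-⊗ S T = trans (total-const S (mass T)) (*-comm (mass T) (mass S))

total-∑ᶠ : ∀ {A k} (S : Summation A) (f : Fin k → A → ℕ) →
  total S (λ a → ∑ᶠ λ i → f i a) ≡ ∑ᶠ λ i → total S (f i)
total-∑ᶠ {k = zero}  S f = total-0 S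
total-∑ᶠ {k = suc k} S f =
  trans (total-+ S _ _) (cong (total S (f zero) +_) (total-∑ᶠ S (f ∘ suc)))

-- Decision trees with lazily tossed coins

𝟙 : Bool → ℕ
𝟙 b = if b then 1 else 0

𝟙≤1 : ∀ b → 𝟙 b ≤ 1
𝟙≤1 false = z≤n
𝟙≤1 true  = ≤-refl

-- Each position looks at a single fair coin, and positions with a common coin are correlated. For a
-- given shape the two families have the same `cell` and differ in `var` alone.
record Experiment (A : Set) (n V : ℕ) : Set where
  field
    cell : Fin n → Bool → A
    var  : Fin n → Fin V

  word : Vec Bool V → Vec A n
  word w = tabulate λ p → cell p (lookup w (var p))

open Experiment public

Record : ℕ → Set
Record V = List (Fin V × Bool)

recall : ∀ {V} → Record V → Fin V → Maybe Bool
recall []            v = nothing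
recall ((u , b) ∷ h) v with u Fin.≟ v
... | yes _ = just b
... | no  _ = recall h v

override : ∀ {V} → Record V → Vec Bool V → Vec Bool V
override []            w = w
override ((v , b) ∷ h) w = override h w [ v ]≔ b

override-recalled : ∀ {V b} (h : Record V) v w → recall h v ≡ just b →
  lookup (override h w) v ≡ b
override-recalled ((u , c) ∷ h) v w eq with u Fin.≟ v
override-recalled ((u , c) ∷ h) .u w refl | yes refl = lookup∘updateAt u (override h w)
... | no u≢v =
  trans (lookup∘updateAt′ v u (u≢v ∘ sym) (override h w)) (override-recalled h v w eq)

override-fresh : ∀ {V} (h : Record V) v b w → recall h v ≡ nothing →
  override h (w [ v ]≔ b) ≡ override h w [ v ]≔ b
override-fresh []            v b w _  = refl
override-fresh ((u , c) ∷ h) v b w eq with u Fin.≟ v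
... | no u≢v = trans (cong (_[ u ]≔ c) (override-fresh h v b w eq))
  ([]≔-commutes (override h w) v u (u≢v ∘ sym))

module _ {A : Set} {n V : ℕ} (e : Experiment A n V) where

  -- The number of accepting coin sequences of length q when the coins are tossed
  -- lazily; an answer that is already determined leaves one coin unused.
  lazy : ∀ {q} → Record V → Algorithm A n q → ℕ
  lazyQuery : ∀ {q} → Record V → Fin n → (A → Algorithm A n q) → Maybe Bool → ℕ

  lazy {q} h (output b)  = 𝟙 b * 2 ^ q
  lazy     h (query p k) = lazyQuery h p k (recall h (var e p))

  lazyQuery h p k (just b) = 2 * lazy h (k (cell e p b))
  lazyQuery h p k nothing  =
    lazy ((var e p , false) ∷ h) (k (cell e p false)) +
    lazy ((var e p , true)  ∷ h) (k (cell e p true))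

  accepted : ∀ {q} → Record V → Algorithm A n q → Vec Bool V → ℕ
  accepted h D w = 𝟙 (run D (word e (override h w)))

  lookup-word : ∀ w p → lookup (word e w) p ≡ cell e p (lookup w (var e p))
  lookup-word w = lookup∘tabulate _

  -- The principle of deferred decisions. Recorded coins are overwritten rather than conditioned on,
  -- so the left side ranges over all of `Vec Bool V` throughout; the powers of 2 bring both counts
  -- to the common space of `V + q` coins.
  lazy-correct : ∀ {q} h (D : Algorithm A n q) →
    ∑ᵇ (accepted h D) * 2 ^ q ≡ 2 ^ V * lazy h D
  lazy-correct {q} h (output b) = begin
    ∑ᵇ {V} (λ _ → 𝟙 b) * 2 ^ q      ≡⟨ cong (_* 2 ^ q) (total-const (bitSum V) (𝟙 b)) ⟩
    𝟙 b * mass (bitSum V) * 2 ^ q   ≡⟨ cong (λ x → 𝟙 b * x * 2 ^ q) (mass-bitSum V) ⟩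
    𝟙 b * 2 ^ V * 2 ^ q             ≡⟨ solve 3 (λ x y z → x :* y :* z := y :* (x :* z)) refl
                                         (𝟙 b) (2 ^ V) (2 ^ q) ⟩
    2 ^ V * (𝟙 b * 2 ^ q)           ∎
    where open ≡-Reasoning
  lazy-correct {suc q} h (query p k) with recall h (var e p) in eq
  ... | just b = begin
    ∑ᵇ (accepted h (query p k)) * (2 * 2 ^ q)
      ≡⟨ cong (_* (2 * 2 ^ q)) (total-cong (bitSum V) answer) ⟩
    ∑ᵇ (accepted h (k (cell e p b))) * (2 * 2 ^ q)
      ≡⟨ solve 2 (λ x y → x :* (con 2 :* y) := con 2 :* (x :* y)) refl
           (∑ᵇ (accepted h (k (cell e p b)))) (2 ^ q) ⟩
    2 * (∑ᵇ (accepted h (k (cell e p b))) * 2 ^ q)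
      ≡⟨ cong (2 *_) (lazy-correct h (k (cell e p b))) ⟩
    2 * (2 ^ V * lazy h (k (cell e p b)))
      ≡⟨ solve 2 (λ x y → con 2 :* (x :* y) := x :* (con 2 :* y)) refl (2 ^ V) _ ⟩
    2 ^ V * (2 * lazy h (k (cell e p b))) ∎
    where
    open ≡-Reasoning
    answer : ∀ w → accepted h (query p k) w ≡ accepted h (k (cell e p b)) w
    answer w = cong (λ a → 𝟙 (run (k a) (word e (override h w))))
      (trans (lookup-word (override h w) p) (cong (cell e p) (override-recalled h _ w eq)))
  ... | nothing = begin
    ∑ᵇ (accepted h (query p k)) * (2 * 2 ^ q)
      ≡⟨ solve 2 (λ x y → x :* (con 2 :* y) := (con 2 :* x) :* y) refl
           (∑ᵇ (accepted h (query p k))) (2 ^ q) ⟩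
    2 * ∑ᵇ (accepted h (query p k)) * 2 ^ q
      ≡⟨ cong (_* 2 ^ q) (trans (∑ᵇ-[]≔ (var e p) (accepted h (query p k)))
           (cong₂ _+_ (total-cong (bitSum V) (answer false))
                      (total-cong (bitSum V) (answer true)))) ⟩
    (∑ᵇ (branch false) + ∑ᵇ (branch true)) * 2 ^ q
      ≡⟨ *-distribʳ-+ (2 ^ q) (∑ᵇ (branch false)) _ ⟩
    ∑ᵇ (branch false) * 2 ^ q + ∑ᵇ (branch true) * 2 ^ q
      ≡⟨ cong₂ _+_ (lazy-correct _ (k (cell e p false))) (lazy-correct _ (k (cell e p true))) ⟩
    _ ≡⟨ *-distribˡ-+ (2 ^ V) (lazy ((var e p , false) ∷ h) (k (cell e p false))) _ ⟨
    _ ∎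
    where
    open ≡-Reasoning
    branch : Bool → Vec Bool V → ℕ
    branch b = accepted ((var e p , b) ∷ h) (k (cell e p b))
    answer : ∀ b w → accepted h (query p k) (w [ var e p ]≔ b) ≡ branch b w
    answer b w rewrite override-fresh h (var e p) b w eq =
      cong (λ a → 𝟙 (run (k a) (word e (override h w [ var e p ]≔ b))))
        (trans (lookup-word (override h w [ var e p ]≔ b) p)
          (cong (cell e p) (lookup∘updateAt (var e p) (override h w))))

  lazy≤ : ∀ {q} h (D : Algorithm A n q) → lazy h D ≤ 2 ^ q
  lazy≤ {q} h (output b) = ≤-trans (*-monoˡ-≤ (2 ^ q) (𝟙≤1 b)) (≤-reflexive (+-identityʳ _))
  lazy≤ h (query p k) with recall h (var e p)
  ... | just b  = *-monoʳ-≤ 2 (lazy≤ h (k (cell e p b)))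
  ... | nothing = +-mono-≤ (lazy≤ _ (k (cell e p false)))
    (≤-trans (lazy≤ _ (k (cell e p true))) (≤-reflexive (sym (+-identityʳ _))))

-- Coupling with the ideal experiment

ideal : ∀ {A n} → (Fin n → Bool → A) → Experiment A n n
ideal c = record { cell = c ; var = id }

-- Away from the positions marked by `suspect` and the pairs marked by `linked`
-- the experiment cannot be told apart from the ideal one.
record Deviation {A : Set} {n V : ℕ} (e : Experiment A n V) (c : Fin n → Bool → A)
                 (suspect : Fin n → Bool) (linked : Fin n → Fin n → Bool) : Set where
  field
    cell≗   : ∀ p → suspect p ≡ false → ∀ b → cell e p b ≡ c p b
    var-inj : ∀ p p′ → suspect p ≡ false → suspect p′ ≡ false → linked p p′ ≡ false →
              var e p′ ≡ var e p → p′ ≡ p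

open Deviation public

module _ {A : Set} {n : ℕ} (c : Fin n → Bool → A)
         (suspect : Fin n → Bool) (linked : Fin n → Fin n → Bool) where

  -- A count of dangers instead of a truth value: being additive, it can be summed over the shapes
  -- term by term.
  caught : Record n → Fin n → ℕ
  caught []            p = 𝟙 (suspect p)
  caught ((p′ , _) ∷ h) p = 𝟙 (linked p p′) + caught h p

  -- `2 ^ q` times the expected number of dangers met on the ideal experiment. The branches depend
  -- on `c` alone, while `suspect` and `linked` merely weigh the nodes; so the queries stay fixed
  -- when the shape varies, although the algorithm is adaptive.
  exposure : ∀ {q} → Record n → Algorithm A n q → ℕ
  exposureQuery : ∀ {q} → Record n → Fin n → (A → Algorithm A n q) → Maybe Bool → ℕ

  exposure         h (output b)  = 0
  exposure {suc q} h (query p k) =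
    caught h p * 2 ^ suc q + exposureQuery h p k (recall h p)

  exposureQuery h p k (just b) = 2 * exposure h (k (c p b))
  exposureQuery h p k nothing  =
    exposure ((p , false) ∷ h) (k (c p false)) + exposure ((p , true) ∷ h) (k (c p true))

-- A union bound, with the sum over shapes moved inside the tree. A query lengthens the history by
-- at most one entry and uses up one unit of `q`, so `length h + q` never grows and bounds every
-- later history.
exposure-total : ∀ {Θ A n} (S : Summation Θ) (c : Fin n → Bool → A)
  (sus : Θ → Fin n → Bool) (lnk : Θ → Fin n → Fin n → Bool) {H J : ℕ} →
  (∀ p → total S (λ θ → 𝟙 (sus θ p)) ≤ H) →
  (∀ p p′ → total S (λ θ → 𝟙 (lnk θ p p′)) ≤ J) →
  ∀ {q} h (D : Algorithm A n q) →
  total S (λ θ → exposure c (sus θ) (lnk θ) h D) ≤ 2 ^ q * (q * (H + J * (length h + q)))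
exposure-total {n = n} S c sus lnk {H} {J} sus≤ lnk≤ = go
  where
  open ≤-Reasoning

  caught≤ : ∀ h p → total S (λ θ → caught c (sus θ) (lnk θ) h p) ≤ H + J * length h
  caught≤ [] p = ≤-trans (sus≤ p) (m≤m+n H (J * 0))
  caught≤ ((p′ , _) ∷ h) p = begin
    total S (λ θ → 𝟙 (lnk θ p p′) + caught c (sus θ) (lnk θ) h p)
      ≡⟨ total-+ S _ _ ⟩
    total S (λ θ → 𝟙 (lnk θ p p′)) + total S (λ θ → caught c (sus θ) (lnk θ) h p)
      ≤⟨ +-mono-≤ (lnk≤ p p′) (caught≤ h p) ⟩
    J + (H + J * length h)
      ≡⟨ solve 3 (λ j h l → j :+ (h :+ j :* l) := h :+ j :* (con 1 :+ l)) refl J H (length h) ⟩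
    H + J * suc (length h) ∎

  step : ∀ q l x → x ≤ 2 * (2 ^ q * (q * (H + J * suc (l + q)))) →
         (H + J * l) * 2 ^ suc q + x ≤ 2 ^ suc q * (suc q * (H + J * (l + suc q)))
  step q l x x≤ = begin
    (H + J * l) * 2 ^ suc q + x
      ≤⟨ +-mono-≤ (*-monoˡ-≤ (2 ^ suc q) (+-monoʳ-≤ H (*-monoʳ-≤ J (m≤m+n l (suc q))))) x≤ ⟩
    (H + J * (l + suc q)) * 2 ^ suc q + 2 * (2 ^ q * (q * (H + J * suc (l + q))))
      ≡⟨ solve 5 (λ H J l q t →
           (H :+ J :* (l :+ (con 1 :+ q))) :* (con 2 :* t) :+
             con 2 :* (t :* (q :* (H :+ J :* (con 1 :+ (l :+ q)))))
           := con 2 :* t :* ((con 1 :+ q) :* (H :+ J :* (l :+ (con 1 :+ q))))) refl H J l q (2 ^ q) ⟩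
    2 ^ suc q * (suc q * (H + J * (l + suc q))) ∎

  go : ∀ {q} h (D : Algorithm _ n q) →
    total S (λ θ → exposure c (sus θ) (lnk θ) h D) ≤ 2 ^ q * (q * (H + J * (length h + q)))
  go {q} h (output b) = ≤-trans (≤-reflexive (total-0 S)) z≤n
  go {suc q} h (query p k) = begin
    total S (λ θ → caught c (sus θ) (lnk θ) h p * 2 ^ suc q + rest θ)
      ≡⟨ total-+ S _ _ ⟩
    total S (λ θ → caught c (sus θ) (lnk θ) h p * 2 ^ suc q) + total S rest
      ≡⟨ cong (_+ total S rest) (total-*ʳ S _ _) ⟩
    total S (λ θ → caught c (sus θ) (lnk θ) h p) * 2 ^ suc q + total S rest
      ≤⟨ +-monoˡ-≤ (total S rest) (*-monoˡ-≤ (2 ^ suc q) (caught≤ h p)) ⟩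
    (H + J * length h) * 2 ^ suc q + total S rest
      ≤⟨ step q (length h) _ (rest≤ (recall h p)) ⟩
    2 ^ suc q * (suc q * (H + J * (length h + suc q))) ∎
    where
    rest = λ θ → exposureQuery c (sus θ) (lnk θ) h p k (recall h p)

    rest≤ : ∀ r → total S (λ θ → exposureQuery c (sus θ) (lnk θ) h p k r) ≤
                  2 * (2 ^ q * (q * (H + J * suc (length h + q))))
    rest≤ (just b) = begin
      total S (λ θ → 2 * exposure c (sus θ) (lnk θ) h (k (c p b)))
        ≡⟨ total-*ˡ S 2 _ ⟩
      2 * total S (λ θ → exposure c (sus θ) (lnk θ) h (k (c p b)))
        ≤⟨ *-monoʳ-≤ 2 (go h (k (c p b))) ⟩
      2 * (2 ^ q * (q * (H + J * (length h + q))))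
        ≤⟨ *-monoʳ-≤ 2 (*-monoʳ-≤ (2 ^ q) (*-monoʳ-≤ q (+-monoʳ-≤ H (*-monoʳ-≤ J (n≤1+n _))))) ⟩
      2 * (2 ^ q * (q * (H + J * suc (length h + q)))) ∎
    rest≤ nothing = begin
      _ ≡⟨ total-+ S _ _ ⟩
      _ ≤⟨ +-mono-≤ (go ((p , false) ∷ h) (k (c p false))) (go ((p , true) ∷ h) (k (c p true))) ⟩
      X + X ≡⟨ cong (X +_) (+-identityʳ X) ⟨
      2 * X ∎
      where X = 2 ^ q * (q * (H + J * suc (length h + q)))

infix 4 _≈_±_
_≈_±_ : ℕ → ℕ → ℕ → Set
x ≈ y ± d = x ≤ y + d × y ≤ x + d

±-refl : ∀ {x y d} → x ≡ y → x ≈ y ± d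
±-refl {x} {d = d} refl = m≤m+n x d , m≤m+n x d

±-weaken : ∀ {x y d d′} → d ≤ d′ → x ≈ y ± d → x ≈ y ± d′
±-weaken {x} {y} d≤d′ (p , q) =
  ≤-trans p (+-monoʳ-≤ y d≤d′) , ≤-trans q (+-monoʳ-≤ x d≤d′)

±-+ : ∀ {x y d x′ y′ d′} → x ≈ y ± d → x′ ≈ y′ ± d′ → x + x′ ≈ y + y′ ± (d + d′)
±-+ {x} {y} {d} {x′} {y′} {d′} (p , q) (p′ , q′) =
  ≤-trans (+-mono-≤ p p′) (≤-reflexive (+-interchange y d y′ d′)) ,
  ≤-trans (+-mono-≤ q q′) (≤-reflexive (+-interchange x d x′ d′))

±-bounded : ∀ {x y d} → x ≤ d → y ≤ d → x ≈ y ± d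
±-bounded {x} {y} x≤d y≤d = ≤-trans x≤d (m≤n+m _ y) , ≤-trans y≤d (m≤n+m _ x)

module _ {A : Set} {n V : ℕ} {e : Experiment A n V} {c : Fin n → Bool → A}
         {suspect : Fin n → Bool} {linked : Fin n → Fin n → Bool}
         (δ : Deviation e c suspect linked) where

  positions : Record n → Record V
  positions = List.map (map₁ (var e))

  data Unsuspected : Record n → Set where
    []  : Unsuspected []
    _∷_ : ∀ {p b h} → suspect p ≡ false → Unsuspected h → Unsuspected ((p , b) ∷ h)

  -- Without danger, the coin of `p` has been seen only if `p` itself was queried: by `var-inj`, an
  -- earlier position with the same coin must be `p`. Hence the history by positions and the history
  -- by coins give the same answer.
  caught≡0 : ∀ {h p} → Unsuspected h → caught c suspect linked h p ≡ 0 →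
    suspect p ≡ false × recall (positions h) (var e p) ≡ recall h p
  caught≡0 {p = p} [] c≡0 with suspect p
  ... | false = refl , refl
  caught≡0 {(p′ , b) ∷ h} {p} (s ∷ ss) c≡0 with linked p p′ in l
  ... | false with caught≡0 ss c≡0
  ...   | sp , same = sp , both
    where
    both : recall (positions ((p′ , b) ∷ h)) (var e p) ≡ recall ((p′ , b) ∷ h) p
    both with var e p′ Fin.≟ var e p | p′ Fin.≟ p
    ... | yes _  | yes _    = refl
    ... | yes v≡ | no p′≢p  = contradiction (var-inj δ p p′ sp s l v≡) p′≢p
    ... | no v≢  | yes refl = contradiction refl v≢
    ... | no _   | no _     = same

  -- Both experiments follow the same branches, with the same answers, up to the first dangerous
  -- query.
  lazy-close : ∀ {q} {h} (D : Algorithm A n q) → Unsuspected h →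
    lazy e (positions h) D ≈ lazy (ideal c) h D ± exposure c suspect linked h D
  lazy-close {q} (output b) ss = ±-refl refl
  lazy-close {suc q} {h} (query p k) ss with caught c suspect linked h p in cg
  -- At a dangerous query this node's share of the exposure is already `2 ^ suc q` or more, the most
  -- that either count can reach, so the subtrees need no comparison.
  ... | suc x = ±-bounded
      (≤-trans (lazy≤ e (positions h) (query p k)) big)
      (≤-trans (lazy≤ (ideal c) h (query p k)) big)
    where
    big : ∀ {y} → 2 ^ suc q ≤ suc x * 2 ^ suc q + y
    big = ≤-trans (m≤m+n _ _) (m≤m+n _ _)
  ... | zero with caught≡0 {h} {p} ss cg
  ...   | sp , same rewrite same with recall h p
  ...     | just b rewrite cell≗ δ p sp b =
    let (x , y) = lazy-close (k (c p b)) ss in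
      ≤-trans (*-monoʳ-≤ 2 x) (≤-reflexive (*-distribˡ-+ 2 (lazy (ideal c) h (k (c p b))) _)) ,
      ≤-trans (*-monoʳ-≤ 2 y) (≤-reflexive (*-distribˡ-+ 2 (lazy e (positions h) (k (c p b))) _))
  ...     | nothing rewrite cell≗ δ p sp false | cell≗ δ p sp true =
    ±-+ (lazy-close (k (c p false)) (sp ∷ ss)) (lazy-close (k (c p true)) (sp ∷ ss))

lazy-totals-close : ∀ {Θ A n V q} (S : Summation Θ) {c : Fin n → Bool → A}
  (e : Θ → Experiment A n V) {sus : Θ → Fin n → Bool} {lnk : Θ → Fin n → Fin n → Bool}
  {H J : ℕ} →
  (∀ θ → Deviation (e θ) c (sus θ) (lnk θ)) →
  (∀ p → total S (λ θ → 𝟙 (sus θ p)) ≤ H) →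
  (∀ p p′ → total S (λ θ → 𝟙 (lnk θ p p′)) ≤ J) →
  (D : Algorithm A n q) →
  total S (λ θ → lazy (e θ) [] D) ≈ total S (λ θ → lazy (ideal c) [] D) ± 2 ^ q * (q * (H + J * q))
lazy-totals-close S {c} e {sus} {lnk} δ sus≤ lnk≤ D = ±-weaken
  (exposure-total S c sus lnk sus≤ lnk≤ [] D)
  ( ≤-trans (total-mono S λ θ → proj₁ (lazy-close (δ θ) D [])) (≤-reflexive (total-+ S _ _))
  , ≤-trans (total-mono S λ θ → proj₂ (lazy-close (δ θ) D [])) (≤-reflexive (total-+ S _ _)))

acceptances : ∀ {Θ A n V q} → Summation Θ → (Θ → Experiment A n V) → Algorithm A n q → ℕ
acceptances {V = V} S e D = total (S ⊗ bitSum V) λ (θ , w) → 𝟙 (run D (word (e θ) w))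

acceptances-lazy : ∀ {Θ A n V q} (S : Summation Θ) (e : Θ → Experiment A n V)
  (D : Algorithm A n q) →
  acceptances S e D * 2 ^ q ≡ 2 ^ V * total S (λ θ → lazy (e θ) [] D)
acceptances-lazy {V = V} {q} S e D = begin
  acceptances S e D * 2 ^ q                                  ≡⟨ total-*ʳ S _ (2 ^ q) ⟨
  total S (λ θ → ∑ᵇ (accepted (e θ) [] D) * 2 ^ q)           ≡⟨ total-cong S (λ θ → lazy-correct (e θ) [] D) ⟩
  total S (λ θ → 2 ^ V * lazy (e θ) [] D)                    ≡⟨ total-*ˡ S (2 ^ V) _ ⟩
  2 ^ V * total S (λ θ → lazy (e θ) [] D)                    ∎
  where open ≡-Reasoning

-- The triangle inequality through the ideal experiment with cells `c`, which is the same for all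
-- shapes; hence the factor 2.
acceptances-close : ∀ {Θ A n V q} (S : Summation Θ) {c : Fin n → Bool → A}
  (e e′ : Θ → Experiment A n V) {sus : Θ → Fin n → Bool} {lnk : Θ → Fin n → Fin n → Bool}
  {H J : ℕ} →
  (∀ θ → Deviation (e θ) c (sus θ) (lnk θ)) →
  (∀ θ → Deviation (e′ θ) c (sus θ) (lnk θ)) →
  (∀ p → total S (λ θ → 𝟙 (sus θ p)) ≤ H) →
  (∀ p p′ → total S (λ θ → 𝟙 (lnk θ p p′)) ≤ J) →
  (D : Algorithm A n q) →
  acceptances S e D ≤ acceptances S e′ D + 2 ^ V * (2 * (q * (H + J * q)))
acceptances-close {V = V} {q} S {c} e e′ {H = H} {J} δ δ′ sus≤ lnk≤ D =
  *-cancelʳ-≤ _ _ (2 ^ q) {{m^n≢0 2 q}} (begin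
    acceptances S e D * 2 ^ q
      ≡⟨ acceptances-lazy S e D ⟩
    2 ^ V * total S (λ θ → lazy (e θ) [] D)
      ≤⟨ *-monoʳ-≤ (2 ^ V) (≤-trans (proj₁ (lazy-totals-close S e δ sus≤ lnk≤ D))
           (+-monoˡ-≤ X (proj₂ (lazy-totals-close S e′ δ′ sus≤ lnk≤ D)))) ⟩
    2 ^ V * (N + X + X)
      ≡⟨ solve 4 (λ v n t b → v :* (n :+ t :* b :+ t :* b) := v :* n :+ v :* (con 2 :* b) :* t) refl
           (2 ^ V) N (2 ^ q) (q * (H + J * q)) ⟩
    2 ^ V * N + 2 ^ V * (2 * (q * (H + J * q))) * 2 ^ q
      ≡⟨ cong (_+ 2 ^ V * (2 * (q * (H + J * q))) * 2 ^ q) (acceptances-lazy S e′ D) ⟨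
    acceptances S e′ D * 2 ^ q + 2 ^ V * (2 * (q * (H + J * q))) * 2 ^ q
      ≡⟨ *-distribʳ-+ (2 ^ q) (acceptances S e′ D) _ ⟨
    (acceptances S e′ D + 2 ^ V * (2 * (q * (H + J * q)))) * 2 ^ q ∎)
  where
  open ≤-Reasoning
  N = total S (λ θ → lazy (e′ θ) [] D)
  X = 2 ^ q * (q * (H + J * q))

-- Dyck words and stacks

Reduces : ∀ {m} → List (Fin m) → List (Paren m) → Set
Reduces st       (opening t ∷ y) = Reduces (t ∷ st) y
Reduces []       []              = ⊤
Reduces (_ ∷ _)  []              = ⊥
Reduces []       (closing _ ∷ _) = ⊥
Reduces (s ∷ st) (closing t ∷ y) = s ≡ t × Reduces st y

-- The arbitrary stack and continuation make the induction pass through `wrap` and `concat`.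
Dyck⇒Reduces : ∀ {m u v} {st : List (Fin m)} → Dyck u → Reduces st v → Reduces st (u ++ v)
Dyck⇒Reduces empty r = r
Dyck⇒Reduces {v = v} {st} (wrap {u} t d) r
  rewrite ++-assoc u [ closing t ] v =
  Dyck⇒Reduces {st = t ∷ st} d (refl , r)
Dyck⇒Reduces {v = v} {st} (concat {u} {u′} d d′) r
  rewrite ++-assoc u u′ v =
  Dyck⇒Reduces {st = st} d (Dyck⇒Reduces {v = v} {st} d′ r)

-- d₀ closing t₁ d₁ ⋯ closing tₖ dₖ with Dyck words dᵢ, for the stack t₁ ∷ ⋯ ∷ tₖ
data Completes {m : ℕ} : List (Fin m) → List (Paren m) → Set where
  done : ∀ {d} → Dyck d → Completes [] d
  pop  : ∀ {d t st y} → Dyck d → Completes st y → Completes (t ∷ st) (d ++ closing t ∷ y)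

prepend : ∀ {m d y} {st : List (Fin m)} → Dyck d → Completes st y → Completes st (d ++ y)
prepend d (done d′)  = done (concat d d′)
prepend {d = d} {st = t ∷ st} δ (pop {d′} {y = y} δ′ c) =
  subst (Completes (t ∷ st)) (++-assoc d d′ (closing t ∷ y)) (pop (concat δ δ′) c)

-- The new opening, the Dyck word before the first pop and the popped closing form one wrapped
-- block, which is absorbed into the Dyck word in front of the next pop.
push : ∀ {m t y} {st : List (Fin m)} → Completes (t ∷ st) y → Completes st (opening t ∷ y)
push {t = t} {st = st} (pop {d} {y = y} δ c) =
  subst (Completes st) (cong (opening t ∷_) (++-assoc d [ closing t ] y))
    (prepend (wrap t δ) c)

Reduces⇒Completes : ∀ {m} (st : List (Fin m)) y → Reduces st y → Completes st y
Reduces⇒Completes []       []              r          = done empty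
Reduces⇒Completes []       (opening t ∷ y) r          = push (Reduces⇒Completes _ y r)
Reduces⇒Completes (s ∷ st) (opening t ∷ y) r          = push (Reduces⇒Completes _ y r)
Reduces⇒Completes (s ∷ st) (closing _ ∷ y) (refl , r) = pop empty (Reduces⇒Completes st y r)

Reduces⇒Dyck : ∀ {m} {y : List (Paren m)} → Reduces [] y → Dyck y
Reduces⇒Dyck {y = y} r with Reduces⇒Completes [] y r
... | done d = d

-- Weighted counting of the words that empty a stack

∏ᶠ : ∀ {k} → (Fin k → ℕ) → ℕ
∏ᶠ {zero}  f = 1
∏ᶠ {suc k} f = f zero * ∏ᶠ (f ∘ suc)

fᵢ≤∑ᶠ : ∀ {k} (f : Fin k → ℕ) i → f i ≤ ∑ᶠ f
fᵢ≤∑ᶠ f zero    = m≤m+n (f zero) _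
fᵢ≤∑ᶠ f (suc i) = ≤-trans (fᵢ≤∑ᶠ (f ∘ suc) i) (m≤n+m _ (f zero))

module _ {m : ℕ} (E : ℕ) where

  affinity : Paren m → Paren m → ℕ
  affinity a c = if does (a ≟ c) then E else 1

  -- The sum of E^(number of agreements of x and y) over all y that empty the stack.
  score : ∀ {n} → List (Fin m) → Vec (Paren m) n → ℕ
  scorePop : ∀ {n} → List (Fin m) → Paren m → Vec (Paren m) n → ℕ

  score st       (a ∷ x) =
    ∑ᶠ (λ t → affinity a (opening t) * score (t ∷ st) x) + scorePop st a x
  score []       []      = 1
  score (_ ∷ _)  []      = 0

  scorePop []       a x = 0
  scorePop (s ∷ st) a x = affinity a (closing s) * score st x

  -- The run of `y` is one term of the sum, of value E^(n-h) with h the distance; multiplying by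
  -- `E ^ hamming x y` avoids the subtraction.
  score≥ : ∀ {n} st (x y : Vec (Paren m) n) → Reduces st (toList y) →
    E ^ n ≤ score st x * E ^ hamming x y
  score≥ []       []      []              r = ≤-refl
  score≥ {suc n} st (a ∷ x) (c ∷ y) r = begin
    E * E ^ n
      ≤⟨ *-monoʳ-≤ E (proj₂ (proj₂ next)) ⟩
    E * (score (proj₁ next) x * E ^ hamming x y)
      ≡⟨ cong (_* (score (proj₁ next) x * E ^ hamming x y)) affinity-hamming ⟩
    affinity a c * E ^ d * (score (proj₁ next) x * E ^ hamming x y)
      ≡⟨ solve 4 (λ α β γ ε → α :* β :* (γ :* ε) := α :* γ :* (β :* ε)) refl
           (affinity a c) (E ^ d) (score (proj₁ next) x) (E ^ hamming x y) ⟩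
    affinity a c * score (proj₁ next) x * (E ^ d * E ^ hamming x y)
      ≡⟨ cong (affinity a c * score (proj₁ next) x *_) (^-distribˡ-+-* E d (hamming x y)) ⟨
    affinity a c * score (proj₁ next) x * E ^ (d + hamming x y)
      ≤⟨ *-monoˡ-≤ (E ^ (d + hamming x y)) (proj₁ (proj₂ next)) ⟩
    score st (a ∷ x) * E ^ (d + hamming x y) ∎
    where
    open ≤-Reasoning
    d = if does (a ≟ c) then 0 else 1

    affinity-hamming : E ≡ affinity a c * E ^ d
    affinity-hamming with does (a ≟ c)
    ... | true  = sym (*-identityʳ E)
    ... | false = sym (trans (+-identityʳ (E * 1)) (*-identityʳ E))

    Next : List (Fin m) → Paren m → Set
    Next st c = ∃[ st′ ] (affinity a c * score st′ x ≤ score st (a ∷ x) ×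
                          E ^ n ≤ score st′ x * E ^ hamming x y)

    step : ∀ st c → Reduces st (c ∷ toList y) → Next st c
    step []       (opening t)  r = t ∷ [] ,
      ≤-trans (fᵢ≤∑ᶠ (λ t → affinity a (opening t) * score (t ∷ []) x) t) (m≤m+n _ _) ,
      score≥ (t ∷ []) x y r
    step (s ∷ st) (opening t)  r = t ∷ s ∷ st ,
      ≤-trans (fᵢ≤∑ᶠ (λ t → affinity a (opening t) * score (t ∷ s ∷ st) x) t) (m≤m+n _ _) ,
      score≥ (t ∷ s ∷ st) x y r
    step (s ∷ st) (closing .s) (refl , r) = st , m≤n+m _ _ , score≥ st x y r

    next = step st c r

  -- The factor by which one letter can multiply the score. All `m` openings are admissible, but
  -- only the closing on top of the stack: this asymmetry makes random closing types expensive.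
  options : Fin m → Paren m → ℕ
  options s a = ∑ᶠ (λ t → affinity a (opening t)) + affinity a (closing s)

  -- Each position has its own coin and the bound is uniform in the stack, so the factors of the
  -- positions multiply. Through `f` a position whose two coin values cannot both be favourable gets
  -- a smaller factor.
  score-total : ∀ (t₀ : Fin m) G {n} (c : Fin n → Bool → Paren m) (f : Fin n → ℕ) →
    (∀ p s → options s (c p false) + options s (c p true) ≤ G * f p) →
    ∀ st → ∑ᵇ (λ w → score st (word (ideal c) w)) ≤ G ^ n * ∏ᶠ f
  score-total t₀ G {zero}  c f opt []       = ≤-refl
  score-total t₀ G {zero}  c f opt (_ ∷ _)  = z≤n
  score-total t₀ G {suc n} c f opt st = begin
    ∑ᵇ (λ w → score st (c zero false ∷ rest w)) + ∑ᵇ (λ w → score st (c zero true ∷ rest w))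
      ≤⟨ +-mono-≤ (branch st (c zero false)) (branch st (c zero true)) ⟩
    options (top st) (c zero false) * B + options (top st) (c zero true) * B
      ≡⟨ *-distribʳ-+ B (options (top st) (c zero false)) _ ⟨
    (options (top st) (c zero false) + options (top st) (c zero true)) * B
      ≤⟨ *-monoˡ-≤ B (opt zero (top st)) ⟩
    G * f zero * (G ^ n * ∏ᶠ (f ∘ suc))
      ≡⟨ solve 4 (λ g h i j → g :* h :* (i :* j) := g :* i :* (h :* j)) refl
           G (f zero) (G ^ n) (∏ᶠ (f ∘ suc)) ⟩
    G * G ^ n * (f zero * ∏ᶠ (f ∘ suc)) ∎
    where
    open ≤-Reasoning
    rest = word (ideal (c ∘ suc))
    B = G ^ n * ∏ᶠ (f ∘ suc)

    IH : ∀ st → ∑ᵇ (λ w → score st (rest w)) ≤ B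
    IH = score-total t₀ G (c ∘ suc) (f ∘ suc) (opt ∘ suc)

    -- An empty stack admits no pop and `scorePop` is 0 there, so the default `t₀` only loosens the
    -- bound.
    top : List (Fin m) → Fin m
    top []      = t₀
    top (s ∷ _) = s

    popped : ∀ st a → ∑ᵇ (λ w → scorePop st a (rest w)) ≤ affinity a (closing (top st)) * B
    popped []       a = ≤-trans (≤-reflexive (total-0 (bitSum n))) z≤n
    popped (s ∷ st) a = ≤-trans
      (≤-reflexive (total-*ˡ (bitSum n) (affinity a (closing s)) (score st ∘ rest)))
      (*-monoʳ-≤ (affinity a (closing s)) (IH st))

    branch : ∀ st a → ∑ᵇ (λ w → score st (a ∷ rest w)) ≤ options (top st) a * B
    branch st a = begin
      ∑ᵇ (λ w → ∑ᶠ (λ t → affinity a (opening t) * score (t ∷ st) (rest w)) + scorePop st a (rest w))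
        ≡⟨ total-+ (bitSum n) _ (λ w → scorePop st a (rest w)) ⟩
      ∑ᵇ (λ w → ∑ᶠ (λ t → affinity a (opening t) * score (t ∷ st) (rest w))) +
      ∑ᵇ (λ w → scorePop st a (rest w))
        ≡⟨ cong (_+ ∑ᵇ (λ w → scorePop st a (rest w)))
             (total-∑ᶠ (bitSum n) λ t w → affinity a (opening t) * score (t ∷ st) (rest w)) ⟩
      ∑ᶠ (λ t → ∑ᵇ (λ w → affinity a (opening t) * score (t ∷ st) (rest w))) +
      ∑ᵇ (λ w → scorePop st a (rest w))
        ≤⟨ +-mono-≤ (total-mono (finSum m) (λ t → ≤-trans
             (≤-reflexive (total-*ˡ (bitSum n) (affinity a (opening t)) (score (t ∷ st) ∘ rest)))
             (*-monoʳ-≤ (affinity a (opening t)) (IH (t ∷ st))))) (popped st a) ⟩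
      ∑ᶠ (λ t → affinity a (opening t) * B) + affinity a (closing (top st)) * B
        ≡⟨ cong (_+ affinity a (closing (top st)) * B) (total-*ʳ (finSum m) (affinity a ∘ opening) B) ⟩
      ∑ᶠ (λ t → affinity a (opening t)) * B + affinity a (closing (top st)) * B
        ≡⟨ *-distribʳ-+ B (∑ᶠ (λ t → affinity a (opening t))) _ ⟨
      options (top st) a * B ∎

  module _ (1≤E : 1 ≤ E) where

    affinity≤ : ∀ a c → affinity a c ≤ E
    affinity≤ a c with does (a ≟ c)
    ... | true  = ≤-refl
    ... | false = 1≤E

    ∑opening : ∀ s → ∑ᶠ (λ t → affinity (opening s) (opening t)) ≤ E + m
    ∑opening = go
      where
      go : ∀ {k} (s : Fin k) → ∑ᶠ (λ t → if does (s Fin.≟ t) then E else 1) ≤ E + k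
      go {suc k} zero    = +-monoʳ-≤ E (≤-trans (≤-reflexive (mass-finSum k)) (n≤1+n k))
      go {suc k} (suc s) = ≤-trans (s≤s (go s)) (≤-reflexive (sym (+-suc E k)))

    options≤ : ∀ s a → options s a ≤ E + suc m
    options≤ s (opening t) = ≤-trans (+-monoˡ-≤ 1 (∑opening t))
      (≤-reflexive (trans (+-comm (E + m) 1) (sym (+-suc E m))))
    options≤ s (closing t) = begin
      ∑ᶠ {m} (λ _ → 1) + affinity (closing t) (closing s)
        ≤⟨ +-mono-≤ (≤-reflexive (mass-finSum m)) (affinity≤ (closing t) (closing s)) ⟩
      m + E      ≤⟨ n≤1+n _ ⟩
      suc m + E  ≡⟨ +-comm (suc m) E ⟩
      E + suc m  ∎
      where open ≤-Reasoning

    -- At most one of two distinct closing types agrees with the top of the stack, so `E` is paid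
    -- once for two coin values instead of twice. The remainder `suc (m + m)` consists of the
    -- openings for both values and the closing that disagrees.
    options-closing : ∀ {t₀ t₁} → t₀ ≢ t₁ → ∀ s →
      options s (closing t₀) + options s (closing t₁) ≤ E + suc (m + m)
    options-closing {t₀} {t₁} t₀≢t₁ s = begin
      options s (closing t₀) + options s (closing t₁)
        ≡⟨ +-interchange (∑ᶠ {m} (λ _ → 1)) (affinity (closing t₀) (closing s)) _ _ ⟩
      (∑ᶠ {m} (λ _ → 1) + ∑ᶠ {m} (λ _ → 1)) +
      (affinity (closing t₀) (closing s) + affinity (closing t₁) (closing s))
        ≤⟨ +-mono-≤ (≤-reflexive (cong₂ _+_ (mass-finSum m) (mass-finSum m))) one ⟩
      (m + m) + suc E ≡⟨ trans (+-suc (m + m) E) (+-comm (suc (m + m)) E) ⟩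
      E + suc (m + m) ∎
      where
      open ≤-Reasoning
      one : affinity (closing t₀) (closing s) + affinity (closing t₁) (closing s) ≤ suc E
      one with t₀ Fin.≟ s | t₁ Fin.≟ s
      ... | yes refl | yes refl = contradiction refl t₀≢t₁
      ... | yes _    | no _     = ≤-reflexive (+-comm E 1)
      ... | no _     | yes _    = ≤-refl
      ... | no _     | no _     = s≤s 1≤E

-- The two families of words

-- Reading `u` turns the stack `st` into `st′`; the form with a continuation composes along `_++_`.
Consumes : ∀ {m} → List (Fin m) → List (Fin m) → List (Paren m) → Set
Consumes st st′ u = ∀ y → Reduces st′ y → Reduces st (u ++ y)

consumes-++ : ∀ {m} {st st′ st″ : List (Fin m)} u v →
  Consumes st st′ u → Consumes st′ st″ v → Consumes st st″ (u ++ v)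
consumes-++ {st = st} u v c d y r =
  subst (Reduces st) (sym (++-assoc u v y)) (c (v ++ y) (d y r))

applyUpTo-+ : ∀ {A : Set} (f : ℕ → A) a b →
  applyUpTo f (a + b) ≡ applyUpTo f a ++ applyUpTo (f ∘ (a +_)) b
applyUpTo-+ f zero    b = refl
applyUpTo-+ f (suc a) b = cong (f 0 ∷_) (applyUpTo-+ (f ∘ suc) a b)

toList-tabulate : ∀ {A : Set} {n} (f : Fin n → A) → toList (tabulate f) ≡ List.tabulate f
toList-tabulate {n = zero}  f = refl
toList-tabulate {n = suc n} f = cong (f zero ∷_) (toList-tabulate (f ∘ suc))

tabulate-+ : ∀ {A : Set} a {b} (f : Fin (a + b) → A) →
  List.tabulate f ≡ List.tabulate (f ∘ (_↑ˡ b)) ++ List.tabulate (f ∘ (a ↑ʳ_))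
tabulate-+ zero    f = refl
tabulate-+ (suc a) f = cong (f zero ∷_) (tabulate-+ a (f ∘ suc))

∏ᶠ-+ : ∀ a {b} (f : Fin (a + b) → ℕ) → ∏ᶠ f ≡ ∏ᶠ (f ∘ (_↑ˡ b)) * ∏ᶠ (f ∘ (a ↑ʳ_))
∏ᶠ-+ zero    f = sym (+-identityʳ _)
∏ᶠ-+ (suc a) f = trans (cong (f zero *_) (∏ᶠ-+ a (f ∘ suc))) (sym (*-assoc (f zero) _ _))

∏ᶠ-const : ∀ {k c} {f : Fin k → ℕ} → (∀ i → f i ≡ c) → ∏ᶠ f ≡ c ^ k
∏ᶠ-const {zero}  f≡c = refl
∏ᶠ-const {suc k} f≡c = cong₂ _*_ (f≡c zero) (∏ᶠ-const (f≡c ∘ suc))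

∑-unique : ∀ {k} (P : Fin k → Bool) →
  (∀ i j → P i ≡ true → P j ≡ true → i ≡ j) → ∑ᶠ (𝟙 ∘ P) ≤ 1
∑-unique {zero}  P u = z≤n
∑-unique {suc k} P u with P zero in eq
... | false = ∑-unique (P ∘ suc) λ i j x y → Fin.suc-injective (u (suc i) (suc j) x y)
... | true  = s≤s (≤-reflexive (trans (total-cong (finSum k) others) (total-0 (finSum k))))
  where
  others : ∀ i → 𝟙 (P (suc i)) ≡ 0
  others i with P (suc i) in eq′
  ... | false = refl
  ... | true  with () ← u zero (suc i) eq eq′

does⇒holds : ∀ {P : Set} (P? : Dec P) → does P? ≡ true → P
does⇒holds (yes p) _ = p

module _ {m : ℕ} where

  region-transparent : ∀ {L W} (H : Fin L → Fin W → Paren m) {st} →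
    (∀ a → Consumes st st (List.tabulate (H a))) →
    Consumes st st (List.tabulate (uncurry H ∘ remQuot {L} W))
  region-consumes : ∀ {L W} (H : Fin L → Fin W → Paren m) (a : Fin L) {st st′} →
    (∀ a′ st → a ≢ a′ → Consumes st st (List.tabulate (H a′))) →
    Consumes st st′ (List.tabulate (H a)) →
    Consumes st st′ (List.tabulate (uncurry H ∘ remQuot {L} W))

  tabulate-rows : ∀ L W (H : Fin (suc L) → Fin W → Paren m) →
    List.tabulate (uncurry H ∘ remQuot {suc L} W) ≡
    List.tabulate (H zero) ++ List.tabulate (uncurry (H ∘ suc) ∘ remQuot {L} W)
  tabulate-rows L W H = trans (tabulate-+ W (uncurry H ∘ remQuot {suc L} W)) (cong₂ _++_
    (tabulate-cong λ i → cong (uncurry H) (Fin.remQuot-combine zero i))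
    (tabulate-cong next))
    where
    next : ∀ i → uncurry H (remQuot {suc L} W (W ↑ʳ i)) ≡ uncurry (H ∘ suc) (remQuot {L} W i)
    next i rewrite Fin.splitAt-↑ʳ W (L * W) i = refl

  region-transparent {zero}  H tr y r = r
  region-transparent {suc L} {W} H {st} tr rewrite tabulate-rows L W H =
    consumes-++ (List.tabulate (H zero)) _ (tr zero) (region-transparent (H ∘ suc) (tr ∘ suc))

  region-consumes {suc L} {W} H zero tr c rewrite tabulate-rows L W H =
    consumes-++ (List.tabulate (H zero)) _ c
      (region-transparent (H ∘ suc) λ a → tr (suc a) _ λ ())
  region-consumes {suc L} {W} H (suc a) tr c rewrite tabulate-rows L W H =
    consumes-++ (List.tabulate (H zero)) _ (tr zero _ λ ())
      (region-consumes (H ∘ suc) a (λ a′ st a≢a′ → tr (suc a′) st (a≢a′ ∘ Fin.suc-injective)) c)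

  -- Types are indexed by the number of the matching closing, innermost pair first, so that the
  -- stack read from the top is `τ 0`, `τ 1` and so on.
  front-consumes : ∀ (τ : ℕ → Fin m) k {st} →
    Consumes st (applyUpTo τ k ++ st) (List.tabulate {n = k} λ i → opening (τ (k ∸ suc (toℕ i))))
  front-consumes τ zero    y r = r
  front-consumes τ (suc k) {st} y r = front-consumes τ k {τ k ∷ st} y
    (subst (λ s → Reduces s y)
      (trans (cong (_++ st) (sym (applyUpTo-∷ʳ τ k))) (∷ʳ-++ (applyUpTo τ k) (τ k) st)) r)

  closings-consume : ∀ (τ : ℕ → Fin m) k {st} →
    Consumes (applyUpTo τ k ++ st) st (List.tabulate {n = k} λ j → closing (τ (toℕ j)))
  closings-consume τ zero    y r = r
  closings-consume τ (suc k) y r = refl , closings-consume (τ ∘ suc) k y r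

  pad : Fin m → ℕ → Paren m
  pad t 0             = opening t
  pad t 1             = closing t
  pad t (suc (suc o)) = pad t o

  pads-transparent : ∀ t R {st} →
    Consumes st st (List.tabulate {n = R * 2} λ o → pad t (toℕ o))
  pads-transparent t zero    y r = r
  pads-transparent t (suc R) y r = refl , pads-transparent t R y r

  -- The run has even length, so the padding after it resumes with an opening and stays balanced;
  -- this is why hidden lengths come in twos.
  run-then-pad : Fin m → ℕ → (ℕ → Fin m) → ℕ → Paren m
  run-then-pad t r τ o = if o <ᵇ r * 2 then closing (τ o) else pad t o

  run-then-pad-consumes : ∀ t {r R} (τ : ℕ → Fin m) {st} → r ≤ R →
    Consumes (applyUpTo τ (r * 2) ++ st) st
             (List.tabulate {n = R * 2} λ o → run-then-pad t r τ (toℕ o))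
  run-then-pad-consumes t {R = R} τ z≤n       y r = pads-transparent t R y r
  run-then-pad-consumes t τ (s≤s r≤R) y r =
    refl , refl , run-then-pad-consumes t (λ o → τ (suc (suc o))) r≤R y r

-- Places, shapes and coins

module Layout {m : ℕ} (t₀ t₁ : Fin m) (L R′ M : ℕ) where

  -- `K` computes to `R * 2 + M`, the number of closings in the middle and the two hidden runs
  -- together; `K′` is the index of the last opening. A segment of width `W` just holds the longest
  -- hidden run, which occurs on the right for r = 0.
  R W K′ K S n : ℕ
  R  = suc R′
  W  = R * 2
  K′ = suc (R′ * 2 + M)
  K  = suc K′
  S  = L * W
  n  = K + (S + (M + S))

  data Place : Set where
    front  : Fin K → Place
    left   : Fin L → Fin W → Place
    middle : Fin M → Place
    right  : Fin L → Fin W → Place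

  place : Fin n → Place
  place = [ front , [ uncurry left ∘ remQuot W , [ middle , uncurry right ∘ remQuot W ]′ ∘ splitAt M ]′
                    ∘ splitAt S ]′ ∘ splitAt K

  unplace : Place → Fin n
  unplace (front i)   = i ↑ˡ (S + (M + S))
  unplace (left a o)  = K ↑ʳ (combine a o ↑ˡ (M + S))
  unplace (middle j)  = K ↑ʳ (S ↑ʳ (j ↑ˡ S))
  unplace (right a o) = K ↑ʳ (S ↑ʳ (M ↑ʳ combine a o))

  place-front : ∀ i → place (i ↑ˡ (S + (M + S))) ≡ front i
  place-front i rewrite Fin.splitAt-↑ˡ K i (S + (M + S)) = refl

  place-left : ∀ s → place (K ↑ʳ (s ↑ˡ (M + S))) ≡ uncurry left (remQuot W s)
  place-left s rewrite Fin.splitAt-↑ʳ K (S + (M + S)) (s ↑ˡ (M + S)) | Fin.splitAt-↑ˡ S s (M + S) = refl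

  place-middle : ∀ j → place (K ↑ʳ (S ↑ʳ (j ↑ˡ S))) ≡ middle j
  place-middle j rewrite Fin.splitAt-↑ʳ K (S + (M + S)) (S ↑ʳ (j ↑ˡ S))
    | Fin.splitAt-↑ʳ S (M + S) (j ↑ˡ S) | Fin.splitAt-↑ˡ M j S = refl

  place-right : ∀ s → place (K ↑ʳ (S ↑ʳ (M ↑ʳ s))) ≡ uncurry right (remQuot W s)
  place-right s rewrite Fin.splitAt-↑ʳ K (S + (M + S)) (S ↑ʳ (M ↑ʳ s))
    | Fin.splitAt-↑ʳ S (M + S) (M ↑ʳ s) | Fin.splitAt-↑ʳ M S s = refl

  place-unplace : ∀ pl → place (unplace pl) ≡ pl
  place-unplace (front i)   = place-front i
  place-unplace (left a o)  = trans (place-left (combine a o)) (cong (uncurry left) (Fin.remQuot-combine a o))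
  place-unplace (middle j)  = place-middle j
  place-unplace (right a o) = trans (place-right (combine a o)) (cong (uncurry right) (Fin.remQuot-combine a o))

  unplace-place : ∀ p → unplace (place p) ≡ p
  unplace-place p with splitAt K p in eq
  ... | inj₁ i = Fin.splitAt⁻¹-↑ˡ eq
  ... | inj₂ p₁ with splitAt S p₁ in eq₁
  ...   | inj₁ s = trans
    (cong (λ s → K ↑ʳ (s ↑ˡ (M + S))) (Fin.combine-remQuot {L} W s))
    (trans (cong (K ↑ʳ_) (Fin.splitAt⁻¹-↑ˡ eq₁)) (Fin.splitAt⁻¹-↑ʳ eq))
  ...   | inj₂ p₂ with splitAt M p₂ in eq₂
  ...     | inj₁ j = trans (cong (λ p → K ↑ʳ (S ↑ʳ p)) (Fin.splitAt⁻¹-↑ˡ eq₂))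
    (trans (cong (K ↑ʳ_) (Fin.splitAt⁻¹-↑ʳ eq₁)) (Fin.splitAt⁻¹-↑ʳ eq))
  ...     | inj₂ s = trans
    (cong (λ s → K ↑ʳ (S ↑ʳ (M ↑ʳ s))) (Fin.combine-remQuot {L} W s))
    (trans (cong (λ p → K ↑ʳ (S ↑ʳ p)) (Fin.splitAt⁻¹-↑ʳ eq₂))
      (trans (cong (K ↑ʳ_) (Fin.splitAt⁻¹-↑ʳ eq₁)) (Fin.splitAt⁻¹-↑ʳ eq)))

  type : Bool → Fin m
  type b = if b then t₁ else t₀

  idealChar : Place → Bool → Paren m
  idealChar (front i)   b = opening (type b)
  idealChar (left a o)  b = pad t₀ (toℕ o)
  idealChar (middle j)  b = closing (type b)
  idealChar (right a o) b = pad t₀ (toℕ o)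

  Θ : Set
  Θ = Fin L × Fin R

  hides : Θ → Place → Bool
  hides (a , _) (left a′ _)  = does (a Fin.≟ a′)
  hides (a , _) (right a′ _) = does (a Fin.≟ a′)
  hides _       _            = false

  char : Θ → Place → Bool → Paren m
  char (a , r) (left a′ o) b =
    if does (a Fin.≟ a′) then run-then-pad t₀ (toℕ r) (λ _ → type b) (toℕ o) else pad t₀ (toℕ o)
  char (a , r) (right a′ o) b =
    if does (a Fin.≟ a′) then run-then-pad t₀ (R ∸ toℕ r) (λ _ → type b) (toℕ o) else pad t₀ (toℕ o)
  char _ pl b = idealChar pl b

  -- The opening parenthesis that matches the closing parenthesis number c.
  partner : ℕ → Place
  partner c = front (fromℕ< {K′ ∸ c} (s≤s (m∸n≤m K′ c)))

  -- Closings are numbered through the left run, the middle and the right run. The padding that ends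
  -- a hidden segment is also assigned a partner, possibly through a truncated subtraction; this is
  -- harmless because `char` ignores the coin there.
  source : Θ → Place → Place
  source (a , r) (front i)    = front i
  source (a , r) (left a′ o)  = if does (a Fin.≟ a′) then partner (toℕ o) else left a′ o
  source (a , r) (middle j)   = partner (toℕ r * 2 + toℕ j)
  source (a , r) (right a′ o) =
    if does (a Fin.≟ a′) then partner (toℕ r * 2 + (M + toℕ o)) else right a′ o

  meets : Fin R → Fin K → Fin M → Bool
  meets r i j = does (toℕ i ℕ.≟ K′ ∸ (toℕ r * 2 + toℕ j))

  -- Hidden closings are already suspect and two middle closings never have a common partner, so the
  -- visible coincidences of coins are those between front and middle, in either order of querying.
  matched : Fin R → Place → Place → Bool
  matched r (front i)  (middle j) = meets r i j
  matched r (middle j) (front i)  = meets r i j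
  matched r _          _          = false

  -- Both have one coin per position, hence a common sample space. In `balanced` a closing reads the
  -- coin of its opening and its own coin goes unread.
  balanced independent : Θ → Experiment (Paren m) n n
  balanced θ = record
    { cell = char θ ∘ place
    ; var  = unplace ∘ source θ ∘ place }
  independent θ = ideal (char θ ∘ place)

  suspect : Θ → Fin n → Bool
  suspect θ = hides θ ∘ place

  linked : Θ → Fin n → Fin n → Bool
  linked (_ , r) p p′ = matched r (place p) (place p′)

  char-visible : ∀ θ pl → hides θ pl ≡ false → ∀ b → char θ pl b ≡ idealChar pl b
  char-visible θ       (front i)    h b = refl
  char-visible (a , r) (left a′ o)  h b rewrite h = refl
  char-visible θ       (middle j)   h b = refl
  char-visible (a , r) (right a′ o) h b rewrite h = refl

  unplace-injective : ∀ {pl pl′} → unplace pl ≡ unplace pl′ → pl ≡ pl′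
  unplace-injective {pl} {pl′} eq =
    trans (sym (place-unplace pl)) (trans (cong place eq) (place-unplace pl′))

  place-injective : ∀ {p p′} → place p ≡ place p′ → p ≡ p′
  place-injective {p} {p′} eq =
    trans (sym (unplace-place p)) (trans (cong unplace eq) (unplace-place p′))

  front-injective : ∀ {i i′} → front i ≡ front i′ → i ≡ i′
  front-injective refl = refl

  index≤K′ : ∀ (r : Fin R) (j : Fin M) → toℕ r * 2 + toℕ j ≤ K′
  index≤K′ r j = ≤-trans
    (+-mono-≤ (*-monoˡ-≤ 2 (≤-pred (Fin.toℕ<n r))) (≤-trans (n≤1+n _) (Fin.toℕ<n j)))
    (n≤1+n _)

  partner-injective : ∀ {c c′} → c ≤ K′ → c′ ≤ K′ → partner c ≡ partner c′ → c ≡ c′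
  partner-injective {c} {c′} c≤ c′≤ eq = ∸-cancelˡ-≡ c≤ c′≤
    (trans (sym (Fin.toℕ-fromℕ< _)) (trans (cong toℕ (front-injective eq)) (Fin.toℕ-fromℕ< _)))

  partner-meets : ∀ r i j → front i ≡ partner (toℕ r * 2 + toℕ j) → meets r i j ≡ true
  partner-meets r i j eq = dec-true (toℕ i ℕ.≟ _)
    (trans (cong toℕ (front-injective eq)) (Fin.toℕ-fromℕ< _))

  visibleSource : Fin R → Place → Place
  visibleSource r (middle j) = partner (toℕ r * 2 + toℕ j)
  visibleSource r pl         = pl

  source-visible : ∀ θ pl → hides θ pl ≡ false → source θ pl ≡ visibleSource (proj₂ θ) pl
  source-visible θ       (front i)    h = refl
  source-visible (a , r) (left a′ o)  h rewrite h = refl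
  source-visible θ       (middle j)   h = refl
  source-visible (a , r) (right a′ o) h rewrite h = refl

  visibleSource-injective : ∀ r pl pl′ → matched r pl pl′ ≡ false →
    visibleSource r pl′ ≡ visibleSource r pl → pl′ ≡ pl
  visibleSource-injective r (front i)   (front i′)   _ eq = eq
  visibleSource-injective r (front i)   (middle j)   f eq =
    contradiction (trans (sym (partner-meets r i j (sym eq))) f) λ ()
  visibleSource-injective r (middle j)  (front i)    f eq =
    contradiction (trans (sym (partner-meets r i j eq)) f) λ ()
  visibleSource-injective r (middle j)  (middle j′)  _ eq =
    cong middle (Fin.toℕ-injective (+-cancelˡ-≡ (toℕ r * 2) _ _
      (partner-injective (index≤K′ r j′) (index≤K′ r j) eq)))
  visibleSource-injective r (left a o)  (left a′ o′) _ eq = eq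
  visibleSource-injective r (right a o) (right a′ o′) _ eq = eq
  visibleSource-injective r (front i)   (left _ _)   _ ()
  visibleSource-injective r (front i)   (right _ _)  _ ()
  visibleSource-injective r (left _ _)  (front _)    _ ()
  visibleSource-injective r (left _ _)  (middle _)   _ ()
  visibleSource-injective r (left _ _)  (right _ _)  _ ()
  visibleSource-injective r (middle _)  (left _ _)   _ ()
  visibleSource-injective r (middle _)  (right _ _)  _ ()
  visibleSource-injective r (right _ _) (front _)    _ ()
  visibleSource-injective r (right _ _) (left _ _)   _ ()
  visibleSource-injective r (right _ _) (middle _)   _ ()

  balanced-deviation : ∀ θ →
    Deviation (balanced θ) (idealChar ∘ place) (suspect θ) (linked θ)
  balanced-deviation θ = record
    { cell≗   = λ p → char-visible θ (place p)
    ; var-inj = λ p p′ s s′ l eq → place-injective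
        (visibleSource-injective (proj₂ θ) (place p) (place p′) l
          (trans (sym (source-visible θ (place p′) s′))
            (trans (unplace-injective eq) (source-visible θ (place p) s)))) }

  independent-deviation : ∀ θ →
    Deviation (independent θ) (idealChar ∘ place) (suspect θ) (linked θ)
  independent-deviation θ = record
    { cell≗   = λ p → char-visible θ (place p)
    ; var-inj = λ p p′ _ _ _ eq → eq }

  shapes : Summation Θ
  shapes = finSum L ⊗ finSum R

  row-total : ∀ a′ → total shapes (λ (a , _) → 𝟙 (does (a Fin.≟ a′))) ≤ R
  row-total a′ = begin
    ∑ᶠ {L} (λ a → ∑ᶠ {R} λ _ → 𝟙 (does (a Fin.≟ a′)))
      ≡⟨ total-cong (finSum L) (λ a → trans (total-const (finSum R) (𝟙 (does (a Fin.≟ a′))))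
           (cong (𝟙 (does (a Fin.≟ a′)) *_) (mass-finSum R))) ⟩
    ∑ᶠ {L} (λ a → 𝟙 (does (a Fin.≟ a′)) * R)
      ≡⟨ total-*ʳ (finSum L) (λ a → 𝟙 (does (a Fin.≟ a′))) R ⟩
    ∑ᶠ {L} (λ a → 𝟙 (does (a Fin.≟ a′))) * R
      ≤⟨ *-monoˡ-≤ R (∑-unique (λ a → does (a Fin.≟ a′))
           λ i j x y → trans (does⇒holds (i Fin.≟ a′) x) (sym (does⇒holds (j Fin.≟ a′) y))) ⟩
    1 * R ≡⟨ *-identityˡ R ⟩
    R ∎
    where open ≤-Reasoning

  hides-total : ∀ pl → total shapes (λ θ → 𝟙 (hides θ pl)) ≤ R
  hides-total (front i)   = ≤-trans (≤-reflexive (total-0 shapes)) z≤n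
  hides-total (left a o)  = row-total a
  hides-total (middle j)  = ≤-trans (≤-reflexive (total-0 shapes)) z≤n
  hides-total (right a o) = row-total a

  -- Increasing `r` moves the partner of a middle closing strictly towards the start, so one shift
  -- at most pairs the two given positions; the segment `a` remains free.
  meets-total : ∀ i j → total shapes (λ (_ , r) → 𝟙 (meets r i j)) ≤ L
  meets-total i j = begin
    ∑ᶠ {L} (λ _ → ∑ᶠ {R} λ r → 𝟙 (meets r i j))
      ≤⟨ total-mono (finSum L) (λ _ → ∑-unique (λ r → meets r i j) unique) ⟩
    mass (finSum L) ≡⟨ mass-finSum L ⟩
    L ∎
    where
    open ≤-Reasoning
    meets⇒≡ : ∀ r → meets r i j ≡ true → toℕ i ≡ K′ ∸ (toℕ r * 2 + toℕ j)
    meets⇒≡ r = does⇒holds (toℕ i ℕ.≟ _)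
    unique : ∀ r r′ → meets r i j ≡ true → meets r′ i j ≡ true → r ≡ r′
    unique r r′ x y = Fin.toℕ-injective (*-cancelʳ-≡ _ _ 2 (+-cancelʳ-≡ (toℕ j) _ _
      (∸-cancelˡ-≡ (index≤K′ r j) (index≤K′ r′ j) (trans (sym (meets⇒≡ r x)) (meets⇒≡ r′ y)))))

  none : total shapes (λ _ → 0) ≤ L
  none = ≤-trans (≤-reflexive (total-0 shapes)) z≤n

  matched-total : ∀ pl pl′ → total shapes (λ (_ , r) → 𝟙 (matched r pl pl′)) ≤ L
  matched-total (front i)   (middle j) = meets-total i j
  matched-total (middle j)  (front i)  = meets-total i j
  matched-total (front _)   (front _)   = none
  matched-total (front _)   (left _ _)  = none
  matched-total (front _)   (right _ _) = none
  matched-total (left _ _)  _           = none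
  matched-total (middle _)  (left _ _)  = none
  matched-total (middle _)  (middle _)  = none
  matched-total (middle _)  (right _ _) = none
  matched-total (right _ _) _           = none

  module _ (θ : Θ) (w : Vec Bool n) where

    private
      a = proj₁ θ
      r = toℕ (proj₂ θ)

      filled : Place → Paren m
      filled pl = char θ pl (lookup w (unplace (source θ pl)))

      τ : ℕ → Fin m
      τ c = type (lookup w (unplace (partner c)))

      leftRow rightRow : Fin L → Fin W → Paren m
      leftRow  a′ o = filled (left a′ o)
      rightRow a′ o = filled (right a′ o)

      τʳ τᵐ : ℕ → Fin m
      τᵐ c = τ (r * 2 + c)
      τʳ c = τ (r * 2 + (M + c))

      front-partner : ∀ i → front i ≡ partner (K′ ∸ toℕ i)
      front-partner i = cong front (Fin.toℕ-injective (sym (trans (Fin.toℕ-fromℕ< _)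
        (m∸[m∸n]≡n (≤-pred (Fin.toℕ<n i))))))

      frontPart leftPart middlePart rightPart : List (Paren m)
      frontPart  = List.tabulate {n = K} λ i → opening (τ (K ∸ suc (toℕ i)))
      leftPart   = List.tabulate (uncurry leftRow ∘ remQuot {L} W)
      middlePart = List.tabulate {n = M} λ j → closing (τᵐ (toℕ j))
      rightPart  = List.tabulate (uncurry rightRow ∘ remQuot {L} W)

      pieces : toList (word (balanced θ) w) ≡
        frontPart ++ (leftPart ++ (middlePart ++ rightPart))
      pieces = begin
        toList (tabulate (filled ∘ place))
          ≡⟨ toList-tabulate (filled ∘ place) ⟩
        List.tabulate (filled ∘ place)
          ≡⟨ tabulate-+ K (filled ∘ place) ⟩
        _ ≡⟨ cong₂ _++_ (tabulate-cong λ i → trans (cong filled (place-front i))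
               (cong (λ pl → opening (type (lookup w (unplace pl)))) (front-partner i)))
               (tabulate-+ S _) ⟩
        _ ≡⟨ cong (frontPart ++_)
               (cong₂ _++_ (tabulate-cong λ s → cong filled (place-left s))
                 (trans (tabulate-+ M _)
                   (cong₂ _++_ (tabulate-cong λ j → cong filled (place-middle j))
                               (tabulate-cong λ s → cong filled (place-right s))))) ⟩
        _ ∎
        where open ≡-Reasoning

      r≤R : r ≤ R
      r≤R = ≤-trans (n≤1+n r) (Fin.toℕ<n (proj₂ θ))

      left-row : ∀ a′ → does (a Fin.≟ a′) ≡ true →
        ∀ o → run-then-pad t₀ r τ (toℕ o) ≡ leftRow a′ o
      left-row a′ eq o rewrite eq = refl

      left-other : ∀ a′ → does (a Fin.≟ a′) ≡ false → ∀ o → pad t₀ (toℕ o) ≡ leftRow a′ o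
      left-other a′ eq o rewrite eq = refl

      right-row : ∀ a′ → does (a Fin.≟ a′) ≡ true →
        ∀ o → run-then-pad t₀ (R ∸ r) τʳ (toℕ o) ≡ rightRow a′ o
      right-row a′ eq o rewrite eq = refl

      right-other : ∀ a′ → does (a Fin.≟ a′) ≡ false → ∀ o → pad t₀ (toℕ o) ≡ rightRow a′ o
      right-other a′ eq o rewrite eq = refl

      -- The stack left by the front, cut where the left run, the middle and the right run take
      -- over; the two hidden runs together supply `R * 2` closings whatever `r` is.
      stack-split : applyUpTo τ K ++ [] ≡
        applyUpTo τ (r * 2) ++ (applyUpTo τᵐ M ++ (applyUpTo τʳ ((R ∸ r) * 2) ++ []))
      stack-split = begin
        applyUpTo τ K ++ []
          ≡⟨ cong (λ k → applyUpTo τ k ++ []) lengths ⟩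
        applyUpTo τ (r * 2 + (M + (R ∸ r) * 2)) ++ []
          ≡⟨ cong (_++ []) (trans (applyUpTo-+ τ (r * 2) _)
               (cong (applyUpTo τ (r * 2) ++_) (applyUpTo-+ τᵐ M _))) ⟩
        (applyUpTo τ (r * 2) ++ (applyUpTo τᵐ M ++ applyUpTo τʳ ((R ∸ r) * 2))) ++ []
          ≡⟨ trans (++-assoc (applyUpTo τ (r * 2)) _ [])
               (cong (applyUpTo τ (r * 2) ++_) (++-assoc (applyUpTo τᵐ M) _ [])) ⟩
        _ ∎
        where
        open ≡-Reasoning
        lengths : R * 2 + M ≡ r * 2 + (M + (R ∸ r) * 2)
        lengths = trans (cong (λ x → x * 2 + M) (sym (m+[n∸m]≡n r≤R)))
          (solve 3 (λ r d M → (r :+ d) :* con 2 :+ M := r :* con 2 :+ (M :+ d :* con 2)) refl r (R ∸ r) M)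

      stᵐ stʳ : List (Fin m)
      stʳ = applyUpTo τʳ ((R ∸ r) * 2) ++ []
      stᵐ = applyUpTo τᵐ M ++ stʳ

      front-step : Consumes [] (applyUpTo τ (r * 2) ++ stᵐ) frontPart
      front-step = subst (λ st → Consumes [] st frontPart) stack-split (front-consumes τ K)

      left-step : Consumes (applyUpTo τ (r * 2) ++ stᵐ) stᵐ leftPart
      left-step = region-consumes leftRow a
        (λ a′ st a≢a′ → subst (Consumes st st)
          (tabulate-cong (left-other a′ (dec-false (a Fin.≟ a′) a≢a′))) (pads-transparent t₀ R))
        (subst (Consumes (applyUpTo τ (r * 2) ++ stᵐ) stᵐ)
          (tabulate-cong (left-row a (dec-true (a Fin.≟ a) refl)))
          (run-then-pad-consumes t₀ τ r≤R))

      right-step : Consumes stʳ [] rightPart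
      right-step = region-consumes rightRow a
        (λ a′ st a≢a′ → subst (Consumes st st)
          (tabulate-cong (right-other a′ (dec-false (a Fin.≟ a′) a≢a′))) (pads-transparent t₀ R))
        (subst (Consumes stʳ [])
          (tabulate-cong (right-row a (dec-true (a Fin.≟ a) refl)))
          (run-then-pad-consumes t₀ τʳ (m∸n≤m R r)))

    balanced-reduces : Reduces [] (toList (word (balanced θ) w))
    balanced-reduces = subst (Reduces []) (trans (++-identityʳ _) (sym pieces))
      (consumes-++ {st = []} {applyUpTo τ (r * 2) ++ stᵐ} {[]} frontPart _ front-step
        (consumes-++ {st = applyUpTo τ (r * 2) ++ stᵐ} {stᵐ} {[]} leftPart _ left-step
          (consumes-++ {st = stᵐ} {stʳ} {[]} middlePart rightPart (closings-consume τᵐ M) right-step))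
        [] tt)

    balanced-Dyck : DyckWord m (word (balanced θ) w)
    balanced-Dyck = Reduces⇒Dyck balanced-reduces

  -- The `f` of `score-total`: 2 is the trivial price of the two coin values, and the middle saves
  -- half of it.
  weightAt : Place → ℕ
  weightAt (middle _) = 1
  weightAt _          = 2

  weightAt-total : 2 ^ M * ∏ᶠ (weightAt ∘ place) ≡ 2 ^ n
  weightAt-total = begin
    2 ^ M * ∏ᶠ (weightAt ∘ place)
      ≡⟨ cong (2 ^ M *_) (trans (∏ᶠ-+ K f) (cong₂ _*_
           (∏ᶠ-const λ i → cong weightAt (place-front i))
           (trans (∏ᶠ-+ S (f ∘ (K ↑ʳ_))) (cong₂ _*_
             (∏ᶠ-const λ s → cong weightAt (place-left s))
             (trans (∏ᶠ-+ M (f ∘ (K ↑ʳ_) ∘ (S ↑ʳ_))) (cong₂ _*_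
               (∏ᶠ-const λ j → cong weightAt (place-middle j))
               (∏ᶠ-const λ s → cong weightAt (place-right s)))))))) ⟩
    2 ^ M * (2 ^ K * (2 ^ S * (1 ^ M * 2 ^ S)))
      ≡⟨ cong (λ x → 2 ^ M * (2 ^ K * (2 ^ S * (x * 2 ^ S)))) (^-zeroˡ M) ⟩
    2 ^ M * (2 ^ K * (2 ^ S * (1 * 2 ^ S)))
      ≡⟨ solve 3 (λ m k s → m :* (k :* (s :* (con 1 :* s))) := k :* (s :* (m :* s))) refl
           (2 ^ M) (2 ^ K) (2 ^ S) ⟩
    2 ^ K * (2 ^ S * (2 ^ M * 2 ^ S))
      ≡⟨ cong (λ x → 2 ^ K * (2 ^ S * x)) (^-distribˡ-+-* 2 M S) ⟨
    2 ^ K * (2 ^ S * 2 ^ (M + S))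
      ≡⟨ cong (2 ^ K *_) (^-distribˡ-+-* 2 S (M + S)) ⟨
    2 ^ K * 2 ^ (S + (M + S))
      ≡⟨ ^-distribˡ-+-* 2 K (S + (M + S)) ⟨
    2 ^ n ∎
    where
    open ≡-Reasoning
    f = weightAt ∘ place

  -- Divided by the number of coin words, the expected score is at most 2^(-M) G^n. The gain is
  -- taken from the middle alone; hidden runs get the crude bound, as padding does.
  independent-score : ∀ {E} → 1 ≤ E → t₀ ≢ t₁ → ∀ θ →
    2 ^ M * ∑ᵇ (λ w → score E [] (word (independent θ) w)) ≤ 2 ^ n * (E + suc (m + m)) ^ n
  independent-score {E} 1≤E t₀≢t₁ θ = begin
    2 ^ M * ∑ᵇ (λ w → score E [] (word (independent θ) w))
      ≤⟨ *-monoʳ-≤ (2 ^ M) (score-total E t₀ G (char θ ∘ place) (weightAt ∘ place)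
           (λ p → choices (place p)) []) ⟩
    2 ^ M * (G ^ n * ∏ᶠ (weightAt ∘ place))
      ≡⟨ solve 3 (λ a b c → a :* (b :* c) := (a :* c) :* b) refl (2 ^ M) (G ^ n) _ ⟩
    2 ^ M * ∏ᶠ (weightAt ∘ place) * G ^ n
      ≡⟨ cong (_* G ^ n) weightAt-total ⟩
    2 ^ n * G ^ n ∎
    where
    open ≤-Reasoning
    G = E + suc (m + m)

    crude : ∀ s a → options E s a ≤ G
    crude s a = ≤-trans (options≤ E 1≤E s a) (+-monoʳ-≤ E (s≤s (m≤m+n m m)))

    any : ∀ s a a′ → options E s a + options E s a′ ≤ G * 2
    any s a a′ = ≤-trans (+-mono-≤ (crude s a) (crude s a′))
      (≤-reflexive (solve 1 (λ g → g :+ g := g :* con 2) refl G))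

    choices : ∀ pl s → options E s (char θ pl false) + options E s (char θ pl true) ≤ G * weightAt pl
    choices (front i)   s = any s (opening t₀) (opening t₁)
    choices (left a o)  s = any s (char θ (left a o) false) (char θ (left a o) true)
    choices (middle j)  s = ≤-trans (options-closing E 1≤E t₀≢t₁ s) (≤-reflexive (sym (*-identityʳ G)))
    choices (right a o) s = any s (char θ (right a o) false) (char θ (right a o) true)

-- Natural weights from real probabilities

Eventually : (ℕ → Set) → Set
Eventually P = ∃[ N ] (∀ i → N ≤ i → P i)

ev-× : ∀ {P Q : ℕ → Set} → Eventually P → Eventually Q → Eventually (λ i → P i × Q i)
ev-× (M , p) (N , q) = M ⊔ N , λ i ≤i →
  p i (m⊔n≤o⇒m≤o M N ≤i) , q i (m⊔n≤o⇒n≤o M N ≤i)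

ev-map : ∀ {P Q : ℕ → Set} → (∀ {i} → P i → Q i) → Eventually P → Eventually Q
ev-map f (N , p) = N , λ i ≤i → f (p i ≤i)

ev-Fin : ∀ {k} {P : Fin k → ℕ → Set} → (∀ j → Eventually (P j)) → Eventually (λ i → ∀ j → P j i)
ev-Fin {zero}  ev = 0 , λ _ _ ()
ev-Fin {suc k} ev = ev-map (λ { (p , ps) zero → p ; (p , ps) (suc j) → ps j })
  (ev-× (ev zero) (ev-Fin (ev ∘ suc)))

ev-Bits : ∀ {n} {P : Vec Bool n → ℕ → Set} →
  (∀ w → Eventually (P w)) → Eventually (λ i → ∀ w → P w i)
ev-Bits {zero}  ev = ev-map (λ { p [] → p }) (ev [])
ev-Bits {suc n} ev = ev-map (λ { (p , q) (false ∷ w) → p w ; (p , q) (true ∷ w) → q w })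
  (ev-× (ev-Bits (ev ∘ (false ∷_))) (ev-Bits (ev ∘ (true ∷_))))

abstract
  ι : ℕ → ℚ
  ι k = pos k ℚ./ 1

  ι-def : ∀ k → ι k ≡ pos k ℚ./ 1
  ι-def k = refl

  toℚᵘ-ι : ∀ k → toℚᵘ (ι k) ℚᵘ.≃ mkℚᵘ (pos k) 0
  toℚᵘ-ι k = ℚ.toℚᵘ-fromℚᵘ (mkℚᵘ (pos k) 0)

  ι-+ : ∀ a b → ι (a + b) ≡ ι a ℚ.+ ι b
  ι-+ a b = ℚ.toℚᵘ-injective (begin
    toℚᵘ (ι (a + b))                      ≈⟨ toℚᵘ-ι (a + b) ⟩
    mkℚᵘ (pos (a + b)) 0                    ≈⟨ *≡* (cong (ℤ._* pos 1)
      (sym (cong₂ ℤ._+_ (ℤ.*-identityʳ (pos a)) (ℤ.*-identityʳ (pos b))))) ⟩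
    mkℚᵘ (pos a) 0 ℚᵘ.+ mkℚᵘ (pos b) 0        ≈⟨ ℚᵘ.+-cong (toℚᵘ-ι a) (toℚᵘ-ι b) ⟨
    toℚᵘ (ι a) ℚᵘ.+ toℚᵘ (ι b)            ≈⟨ ℚ.toℚᵘ-homo-+ (ι a) (ι b) ⟨
    toℚᵘ (ι a ℚ.+ ι b)                    ∎)
    where open ℚᵘ.≃-Reasoning

  ι-* : ∀ a b → ι (a * b) ≡ ι a ℚ.* ι b
  ι-* a b = ℚ.toℚᵘ-injective (begin
    toℚᵘ (ι (a * b))                      ≈⟨ toℚᵘ-ι (a * b) ⟩
    mkℚᵘ (pos (a * b)) 0                    ≈⟨ *≡* (cong (ℤ._* pos 1) (ℤ.pos-* a b)) ⟩
    mkℚᵘ (pos a) 0 ℚᵘ.* mkℚᵘ (pos b) 0        ≈⟨ ℚᵘ.*-cong (toℚᵘ-ι a) (toℚᵘ-ι b) ⟨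
    toℚᵘ (ι a) ℚᵘ.* toℚᵘ (ι b)            ≈⟨ ℚ.toℚᵘ-homo-* (ι a) (ι b) ⟨
    toℚᵘ (ι a ℚ.* ι b)                    ∎)
    where open ℚᵘ.≃-Reasoning

  ι-cancel-≤ : ∀ {a b} → ι a ℚ.≤ ι b → a ≤ b
  ι-cancel-≤ {a} {b} le with ℚᵘ.≤-respˡ-≃ (toℚᵘ-ι a) (ℚᵘ.≤-respʳ-≃ (toℚᵘ-ι b) (ℚ.toℚᵘ-mono-≤ le))
  ... | *≤* p = ℤ.drop‿+≤+ (subst₂ ℤ._≤_ (ℤ.*-identityʳ (pos a)) (ℤ.*-identityʳ (pos b)) p)

  0≤ι : ∀ k → 0ℚ ℚ.≤ ι k
  0≤ι k = ℚ.toℚᵘ-cancel-≤ (ℚᵘ.≤-respʳ-≃ (ℚᵘ.≃-sym (toℚᵘ-ι k))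
    (*≤* (subst (pos 0 ℤ.≤_) (sym (ℤ.*-identityʳ (pos k))) (ℤ.+≤+ z≤n))))

-- Defs.∑ taken pointwise.
∑ℚ : ∀ {k} → (Fin k → ℚ) → ℚ
∑ℚ {zero}  f = 0ℚ
∑ℚ {suc k} f = f zero ℚ.+ ∑ℚ (f ∘ suc)

seq-∑ : ∀ {k} (f : Fin k → ℝ) i → seq (∑ f) i ≡ ∑ℚ (λ j → seq (f j) i)
seq-∑ {zero}  f i = refl
seq-∑ {suc k} f i = cong (seq (f zero) i ℚ.+_) (seq-∑ (f ∘ suc) i)

∑ℚ-cong : ∀ {k} {f g : Fin k → ℚ} → (∀ j → f j ≡ g j) → ∑ℚ f ≡ ∑ℚ g
∑ℚ-cong {zero}  eq = refl
∑ℚ-cong {suc k} eq = cong₂ ℚ._+_ (eq zero) (∑ℚ-cong (eq ∘ suc))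

∑ℚ-mono : ∀ {k} {f g : Fin k → ℚ} → (∀ j → f j ℚ.≤ g j) → ∑ℚ f ℚ.≤ ∑ℚ g
∑ℚ-mono {zero}  le = ℚ.≤-refl
∑ℚ-mono {suc k} le = ℚ.+-mono-≤ (le zero) (∑ℚ-mono (le ∘ suc))

∑ℚ-shift : ∀ {k} (f : Fin k → ℚ) δ → ∑ℚ (λ j → f j ℚ.+ δ) ≡ ∑ℚ f ℚ.+ ι k ℚ.* δ
∑ℚ-shift {zero}  f δ = sym (trans (ℚ.+-identityˡ _) (trans (cong (ℚ._* δ) (ι-def 0)) (ℚ.*-zeroˡ δ)))
∑ℚ-shift {suc k} f δ = begin
  (f zero ℚ.+ δ) ℚ.+ ∑ℚ (λ j → f (suc j) ℚ.+ δ)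
    ≡⟨ cong ((f zero ℚ.+ δ) ℚ.+_) (∑ℚ-shift (f ∘ suc) δ) ⟩
  (f zero ℚ.+ δ) ℚ.+ (∑ℚ (f ∘ suc) ℚ.+ ι k ℚ.* δ)
    ≡⟨ solveℚ 4 (λ x d y k → (x ⊕ d) ⊕ (y ⊕ k ⊛ d) ⊜ (x ⊕ y) ⊕ (conℚ 1ℚ ⊕ k) ⊛ d) refl
         (f zero) δ (∑ℚ (f ∘ suc)) (ι k) ⟩
  (f zero ℚ.+ ∑ℚ (f ∘ suc)) ℚ.+ (1ℚ ℚ.+ ι k) ℚ.* δ
    ≡⟨ cong (λ x → (f zero ℚ.+ ∑ℚ (f ∘ suc)) ℚ.+ x ℚ.* δ)
         (trans (ι-+ 1 k) (cong (ℚ._+ ι k) (ι-def 1))) ⟨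
  _ ∎
  where
  open ≡-Reasoning

∑ℚ-scale : ∀ {k D} {f : Fin k → ℚ} {g : Fin k → ℕ} →
  (∀ j → f j ℚ.* ι D ≡ ι (g j)) → ∑ℚ f ℚ.* ι D ≡ ι (∑ᶠ g)
∑ℚ-scale {zero}  {D}         eq = trans (ℚ.*-zeroˡ (ι D)) (sym (ι-def 0))
∑ℚ-scale {suc k} {D} {f} {g} eq = begin
  (f zero ℚ.+ ∑ℚ (f ∘ suc)) ℚ.* ι D            ≡⟨ ℚ.*-distribʳ-+ (ι D) (f zero) _ ⟩
  f zero ℚ.* ι D ℚ.+ ∑ℚ (f ∘ suc) ℚ.* ι D      ≡⟨ cong₂ ℚ._+_ (eq zero) (∑ℚ-scale (eq ∘ suc)) ⟩
  ι (g zero) ℚ.+ ι (∑ᶠ (g ∘ suc))              ≡⟨ ι-+ (g zero) _ ⟨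
  ι (∑ᶠ g)                                     ∎
  where open ≡-Reasoning

numerator-denominator : ∀ b → 0ℚ ℚ.≤ b → ∃[ d ] ∃[ k ] b ℚ.* ι (suc d) ≡ ι k
numerator-denominator b@(mkℚ (pos k) d c) _ = d , k , ℚ.toℚᵘ-injective (begin
  toℚᵘ (b ℚ.* ι (suc d))                   ≈⟨ ℚ.toℚᵘ-homo-* b (ι (suc d)) ⟩
  mkℚᵘ (pos k) d ℚᵘ.* toℚᵘ (ι (suc d))       ≈⟨ ℚᵘ.*-congˡ {mkℚᵘ (pos k) d} (toℚᵘ-ι (suc d)) ⟩
  mkℚᵘ (pos k) d ℚᵘ.* mkℚᵘ (pos (suc d)) 0       ≈⟨ *≡* (trans (ℤ.*-identityʳ _)
                                                 (cong (λ x → pos k ℤ.* pos x) (sym (*-identityʳ (suc d))))) ⟩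
  mkℚᵘ (pos k) 0                             ≈⟨ toℚᵘ-ι k ⟨
  toℚᵘ (ι k)                               ∎)
  where open ℚᵘ.≃-Reasoning
numerator-denominator (mkℚ -[1+ k ] d c) (ℚ.*≤* ())

common-denominator : ∀ {s} (b : Fin s → ℚ) → (∀ j → 0ℚ ℚ.≤ b j) →
  ∃[ D ] Σ[ ω ∈ (Fin s → ℕ) ] (NonZero D × (∀ j → b j ℚ.* ι D ≡ ι (ω j)))
common-denominator {zero}  b b≥0 = 1 , (λ ()) , _ , λ ()
common-denominator {suc s} b b≥0
  with numerator-denominator (b zero) (b≥0 zero) | common-denominator (b ∘ suc) (b≥0 ∘ suc)
... | d , k , eq | D , ω , D≢0 , eqs = suc d * D , ω′ , m*n≢0 (suc d) D {{_}} {{D≢0}} , eqs′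
  where
  open ≡-Reasoning
  ω′ : Fin (suc s) → ℕ
  ω′ zero    = k * D
  ω′ (suc j) = suc d * ω j
  eqs′ : ∀ j → b j ℚ.* ι (suc d * D) ≡ ι (ω′ j)
  eqs′ zero = begin
    b zero ℚ.* ι (suc d * D)           ≡⟨ cong (b zero ℚ.*_) (ι-* (suc d) D) ⟩
    b zero ℚ.* (ι (suc d) ℚ.* ι D)     ≡⟨ ℚ.*-assoc (b zero) (ι (suc d)) (ι D) ⟨
    b zero ℚ.* ι (suc d) ℚ.* ι D       ≡⟨ cong (ℚ._* ι D) eq ⟩
    ι k ℚ.* ι D                        ≡⟨ ι-* k D ⟨
    ι (k * D)                          ∎
  eqs′ (suc j) = begin
    b (suc j) ℚ.* ι (suc d * D)        ≡⟨ cong (b (suc j) ℚ.*_)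
                                            (trans (cong ι (*-comm (suc d) D)) (ι-* D (suc d))) ⟩
    b (suc j) ℚ.* (ι D ℚ.* ι (suc d))  ≡⟨ ℚ.*-assoc (b (suc j)) (ι D) (ι (suc d)) ⟨
    b (suc j) ℚ.* ι D ℚ.* ι (suc d)    ≡⟨ cong (ℚ._* ι (suc d)) (eqs j) ⟩
    ι (ω j) ℚ.* ι (suc d)              ≡⟨ trans (cong ι (*-comm (suc d) (ω j))) (ι-* (ω j) (suc d)) ⟨
    ι (suc d * ω j)                    ∎

abstract
  -- Any κ up to 1/39 satisfies 5(1+κ) ≤ 8(2/3-κ), which is how a share of 2/3 survives the rounding
  -- as a share of 5/8.
  κ : ℚ
  κ = pos 1 ℚ./ 48

  unitFraction : ℕ → ℚ
  unitFraction s = mkℚ (pos 1) s (1-coprimeTo (suc s))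

  -- Raising `s` weights by the tolerance, with one more tolerance for the error in their sum, costs
  -- exactly κ; hence κ/(s+1).
  tolerance : ℕ → ℚ
  tolerance s = κ ℚ.* unitFraction s

  0<tolerance : ∀ s → 0ℚ ℚ.< tolerance s
  0<tolerance s = ℚ.*-monoʳ-<-pos κ (ℚ.positive⁻¹ (unitFraction s))

  tolerance-total : ∀ s → tolerance s ℚ.+ ι s ℚ.* tolerance s ≡ κ
  tolerance-total s = begin
    δ ℚ.+ ι s ℚ.* δ          ≡⟨ solveℚ 2 (λ d k → d ⊕ k ⊛ d ⊜ d ⊛ (conℚ 1ℚ ⊕ k)) refl δ (ι s) ⟩
    δ ℚ.* (1ℚ ℚ.+ ι s)       ≡⟨ cong (δ ℚ.*_) (trans (cong (ℚ._+ ι s) (sym (ι-def 1))) (sym (ι-+ 1 s))) ⟩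
    δ ℚ.* ι (suc s)          ≡⟨ ℚ.*-assoc κ (unitFraction s) (ι (suc s)) ⟩
    κ ℚ.* (unitFraction s ℚ.* ι (suc s))
      ≡⟨ cong (κ ℚ.*_) (trans (proj₂ (proj₂ (numerator-denominator (unitFraction s)
           (ℚ.nonNegative⁻¹ (unitFraction s))))) (ι-def 1)) ⟩
    κ ℚ.* 1ℚ                 ≡⟨ ℚ.*-identityʳ κ ⟩
    κ                        ∎
    where
    open ≡-Reasoning
    δ : ℚ
    δ = tolerance s

  0≤ι*tolerance : ∀ s → 0ℚ ℚ.≤ ι s ℚ.* tolerance s
  0≤ι*tolerance s = ℚ.nonNegative⁻¹ _
    {{ℚ.nonNeg*nonNeg⇒nonNeg (ι s) {{ℚ.nonNegative (0≤ι s)}} (tolerance s)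
      {{ℚ.nonNegative (ℚ.<⇒≤ (0<tolerance s))}}}}

  tolerance≤κ : ∀ s → tolerance s ℚ.≤ κ
  tolerance≤κ s = begin
    δ                    ≡⟨ ℚ.+-identityʳ δ ⟨
    δ ℚ.+ 0ℚ             ≤⟨ ℚ.+-monoʳ-≤ δ (0≤ι*tolerance s) ⟩
    δ ℚ.+ ι s ℚ.* δ      ≡⟨ tolerance-total s ⟩
    κ                    ∎
    where
    open ℚ.≤-Reasoning
    δ : ℚ
    δ = tolerance s

  κ-small : (pos 1 ℚ./ 1) ℚ.* 1ℚ ℚ.≤ (pos 2 ℚ./ 1) ℚ.* (1ℚ ℚ.- κ)
  κ-small = from-yes ((pos 1 ℚ./ 1) ℚ.* 1ℚ ℚ.≤? (pos 2 ℚ./ 1) ℚ.* (1ℚ ℚ.- κ))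

  κ-majority : (pos 5 ℚ./ 1) ℚ.* (1ℚ ℚ.+ κ) ℚ.≤ (pos 8 ℚ./ 1) ℚ.* ((pos 2 ℚ./ 3) ℚ.- κ)
  κ-majority = from-yes ((pos 5 ℚ./ 1) ℚ.* (1ℚ ℚ.+ κ) ℚ.≤? (pos 8 ℚ./ 1) ℚ.* ((pos 2 ℚ./ 3) ℚ.- κ))

-- Shifting all weights by the tolerance makes them nonnegative; clearing
-- denominators then turns them into naturals.
module Rounding {s : ℕ} (a : Fin s → ℚ)
  (a≥0 : ∀ j → 0ℚ ℚ.≤ a j ℚ.+ tolerance s)
  (∑a≤ : ∑ℚ a ℚ.≤ 1ℚ ℚ.+ tolerance s)
  (∑a≥ : 1ℚ ℚ.≤ ∑ℚ a ℚ.+ tolerance s) where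

  private
    δ : ℚ
    δ = tolerance s

    b : Fin s → ℚ
    b j = a j ℚ.+ δ

    cleared = common-denominator b a≥0
    D = proj₁ cleared

  ω : Fin s → ℕ
  ω = proj₁ (proj₂ cleared)

  private
    instance
      D≢0 : NonZero D
      D≢0 = proj₁ (proj₂ (proj₂ cleared))

    b·D≡ω : ∀ j → b j ℚ.* ι D ≡ ι (ω j)
    b·D≡ω = proj₂ (proj₂ (proj₂ cleared))

    masked : (Fin s → Bool) → Fin s → ℚ
    masked c j = if c j then a j else 0ℚ

    maskedω : ∀ (c : Fin s → Bool) j → (if c j then b j else 0ℚ) ℚ.* ι D ≡ ι (ω j * 𝟙 (c j))
    maskedω c j with c j
    ... | true  = trans (b·D≡ω j) (cong ι (sym (*-identityʳ (ω j))))
    ... | false = trans (ℚ.*-zeroˡ (ι D)) (trans (sym (ι-def 0)) (cong ι (sym (*-zeroʳ (ω j)))))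

    instance
      ιD≥0 : ℚ.NonNegative (ι D)
      ιD≥0 = ℚ.nonNegative (0≤ι D)

    ∑b≤ : ∑ℚ b ℚ.≤ 1ℚ ℚ.+ κ
    ∑b≤ = begin
      ∑ℚ b                               ≡⟨ ∑ℚ-shift a δ ⟩
      ∑ℚ a ℚ.+ ι s ℚ.* δ                 ≤⟨ ℚ.+-monoˡ-≤ (ι s ℚ.* δ) ∑a≤ ⟩
      (1ℚ ℚ.+ δ) ℚ.+ ι s ℚ.* δ           ≡⟨ ℚ.+-assoc 1ℚ δ (ι s ℚ.* δ) ⟩
      1ℚ ℚ.+ (δ ℚ.+ ι s ℚ.* δ)           ≡⟨ cong (1ℚ ℚ.+_) (tolerance-total s) ⟩
      1ℚ ℚ.+ κ                           ∎
      where open ℚ.≤-Reasoning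

    masked≤ : ∀ (c : Fin s → Bool) j → masked c j ℚ.≤ (if c j then b j else 0ℚ)
    masked≤ c j with c j
    ... | true  = ℚ.≤-trans (ℚ.≤-reflexive (sym (ℚ.+-identityʳ (a j))))
                    (ℚ.+-monoʳ-≤ (a j) (ℚ.<⇒≤ (0<tolerance s)))
    ... | false = ℚ.≤-refl

    cancelκ : ∀ {x y} → x ℚ.≤ y ℚ.+ δ → x ℚ.- κ ℚ.≤ y
    cancelκ {x} {y} le = begin
      x ℚ.- κ            ≤⟨ ℚ.+-monoˡ-≤ (ℚ.- κ) (ℚ.≤-trans le (ℚ.+-monoʳ-≤ y (tolerance≤κ s))) ⟩
      (y ℚ.+ κ) ℚ.- κ    ≡⟨ solveℚ 2 (λ y k → (y ⊕ k) ⊕ ⊝ k ⊜ y) refl y κ ⟩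
      y                  ∎
      where
      open ℚ.≤-Reasoning

    ∑b≥ : 1ℚ ℚ.- κ ℚ.≤ ∑ℚ b
    ∑b≥ = begin
      1ℚ ℚ.- κ                  ≤⟨ cancelκ ∑a≥ ⟩
      ∑ℚ a                      ≡⟨ ℚ.+-identityʳ (∑ℚ a) ⟨
      ∑ℚ a ℚ.+ 0ℚ               ≤⟨ ℚ.+-monoʳ-≤ (∑ℚ a) (0≤ι*tolerance s) ⟩
      ∑ℚ a ℚ.+ ι s ℚ.* δ        ≡⟨ ∑ℚ-shift a δ ⟨
      ∑ℚ b                      ∎
      where open ℚ.≤-Reasoning

    clear-≤ : ∀ k l {x y f g} → x ℚ.* ι D ≡ ι f → y ℚ.* ι D ≡ ι g →
      (pos k ℚ./ 1) ℚ.* x ℚ.≤ (pos l ℚ./ 1) ℚ.* y → k * f ≤ l * g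
    clear-≤ k l {x} {y} {f} {g} xD yD le = ι-cancel-≤ (begin
      ι (k * f)                       ≡⟨ clear k xD ⟨
      (pos k ℚ./ 1) ℚ.* x ℚ.* ι D       ≤⟨ ℚ.*-monoʳ-≤-nonNeg (ι D) le ⟩
      (pos l ℚ./ 1) ℚ.* y ℚ.* ι D       ≡⟨ clear l yD ⟩
      ι (l * g)                       ∎)
      where
      open ℚ.≤-Reasoning
      clear : ∀ k {x f} → x ℚ.* ι D ≡ ι f → (pos k ℚ./ 1) ℚ.* x ℚ.* ι D ≡ ι (k * f)
      clear k {x} {f} xD = trans (cong (λ c → c ℚ.* x ℚ.* ι D) (sym (ι-def k)))
        (trans (ℚ.*-assoc (ι k) x (ι D)) (trans (cong (ι k ℚ.*_) xD) (sym (ι-* k f))))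

  mass-positive : 0 < ∑ᶠ ω
  mass-positive = *-cancelˡ-< 2 0 _ (≤-trans (>-nonZero⁻¹ D)
    (≤-trans (≤-reflexive (sym (*-identityˡ D)))
      (clear-≤ 1 2 {y = ∑ℚ b} (ℚ.*-identityˡ (ι D)) (∑ℚ-scale {D = D} {b} b·D≡ω)
        (ℚ.≤-trans κ-small (ℚ.*-monoˡ-≤-nonNeg (pos 2 ℚ./ 1) ∑b≥)))))

  -- The shift raises the whole sum to at most 1+κ and does not lower the part selected by `c`,
  -- which is at least 2/3-κ.
  majority : ∀ (c : Fin s → Bool) → (pos 2 ℚ./ 3) ℚ.≤ ∑ℚ (masked c) ℚ.+ δ →
    5 * ∑ᶠ ω ≤ 8 * ∑ᶠ (λ j → ω j * 𝟙 (c j))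
  majority c ⅔≤ = clear-≤ 5 8 {∑ℚ b} {∑ℚ λ j → if c j then b j else 0ℚ}
    (∑ℚ-scale {D = D} {b} b·D≡ω) (∑ℚ-scale {D = D} (maskedω c)) (begin
    (pos 5 ℚ./ 1) ℚ.* ∑ℚ b
      ≤⟨ ℚ.*-monoˡ-≤-nonNeg (pos 5 ℚ./ 1) ∑b≤ ⟩
    (pos 5 ℚ./ 1) ℚ.* (1ℚ ℚ.+ κ)
      ≤⟨ κ-majority ⟩
    (pos 8 ℚ./ 1) ℚ.* ((pos 2 ℚ./ 3) ℚ.- κ)
      ≤⟨ ℚ.*-monoˡ-≤-nonNeg (pos 8 ℚ./ 1) (ℚ.≤-trans (cancelκ ⅔≤) (∑ℚ-mono (masked≤ c))) ⟩
    (pos 8 ℚ./ 1) ℚ.* ∑ℚ (λ j → if c j then b j else 0ℚ) ∎)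
    where open ℚ.≤-Reasoning

-- Finiteness in the form required here: the thresholds of all members have a common upper bound.
Enumerable : Set → Set₁
Enumerable I = ∀ {P : I → ℕ → Set} → (∀ x → Eventually (P x)) → Eventually (λ i → ∀ x → P x i)

enum-× : ∀ {I J} → Enumerable I → Enumerable J → Enumerable (I × J)
enum-× I J ev = ev-map (λ { f (x , y) → f x y }) (I λ x → J λ y → ev (x , y))

module _ {A : Set} {n q : ℕ} (T : RandomizedAlgorithm A n q) where

  accepting : Vec A n → Fin (size T) → Bool
  accepting x j = run (algorithm T j) x

  -- Finitely many inputs give finitely many inequalities between reals, so a single index of the
  -- Cauchy sequences satisfies them all up to `δ`. The rational weights at that index are then
  -- rounded.
  natural-weights : ∀ {I J} → Enumerable I → Enumerable J →
    (x : I → Vec A n) → (∀ i → ⅔ ≤ℝ Pr[ T on x i accepts]) →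
    (y : J → Vec A n) (far : J → Bool) → (∀ j → far j ≡ true → ⅔ ≤ℝ Pr[ T on y j rejects]) →
    Σ[ ω ∈ (Fin (size T) → ℕ) ]
      (0 < ∑ᶠ ω ×
       (∀ i → 5 * ∑ᶠ ω ≤ 8 * ∑ᶠ (λ k → ω k * 𝟙 (accepting (x i) k))) ×
       (∀ j → far j ≡ true → 5 * ∑ᶠ ω ≤ 8 * ∑ᶠ (λ k → ω k * 𝟙 (not (accepting (y j) k)))))
  natural-weights {I} {J} enumI enumJ x acc y far rej = ω , mass-positive ,
    (λ i → majority (accepting (x i)) (accepts i)) ,
    (λ j f → majority (not ∘ accepting (y j)) (rejects j f))
    where
    s = size T
    δ : ℚ
    δ = tolerance s

    a : ℕ → Fin s → ℚ
    a i j = seq (weight T j) i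

    ∑if : ∀ (c : Fin s → Bool) i → seq (∑ λ j → if c j then weight T j else 0ℝ) i ≡
      ∑ℚ (λ j → if c j then a i j else 0ℚ)
    ∑if c i = trans (seq-∑ (λ j → if c j then weight T j else 0ℝ) i) (∑ℚ-cong pointwise)
      where
      pointwise : ∀ j → seq (if c j then weight T j else 0ℝ) i ≡ (if c j then a i j else 0ℚ)
      pointwise j with c j
      ... | true  = refl
      ... | false = refl

    ∑if-not : ∀ (c : Fin s → Bool) i → seq (∑ λ j → if c j then 0ℝ else weight T j) i ≡
      ∑ℚ (λ j → if not (c j) then a i j else 0ℚ)
    ∑if-not c i = trans (seq-∑ (λ j → if c j then 0ℝ else weight T j) i) (∑ℚ-cong pointwise)
      where
      pointwise : ∀ j → seq (if c j then 0ℝ else weight T j) i ≡ (if not (c j) then a i j else 0ℚ)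
      pointwise j with c j
      ... | true  = refl
      ... | false = refl

    -- The threshold index has to be produced before the hypothesis `far j ≡ true` is available; as
    -- `far` is Boolean, it can be decided first.
    rejection : ∀ j → Eventually (λ i → far j ≡ true → (pos 2 ℚ./ 3) ℚ.≤ seq Pr[ T on y j rejects] i ℚ.+ δ)
    rejection j with far j in eq
    ... | true  = ev-map (λ le _ → le) (rej j eq δ (0<tolerance s))
    ... | false = 0 , λ _ _ ()

    late : Eventually λ i →
      (∀ j → 0ℚ ℚ.≤ a i j ℚ.+ δ) × (seq (∑ (weight T)) i ℚ.≤ 1ℚ ℚ.+ δ) ×
      (1ℚ ℚ.≤ seq (∑ (weight T)) i ℚ.+ δ) ×
      (∀ v → (pos 2 ℚ./ 3) ℚ.≤ seq Pr[ T on x v accepts] i ℚ.+ δ) ×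
      (∀ v → far v ≡ true → (pos 2 ℚ./ 3) ℚ.≤ seq Pr[ T on y v rejects] i ℚ.+ δ)
    late = ev-× (ev-Fin λ j → weight≥0 T j δ (0<tolerance s))
          (ev-× (proj₁ (∑weight≃1 T) δ (0<tolerance s))
          (ev-× (proj₂ (∑weight≃1 T) δ (0<tolerance s))
          (ev-× (enumI λ v → acc v δ (0<tolerance s))
                (enumJ rejection))))

    N = proj₁ late
    facts = proj₂ late N ≤-refl

    open Rounding (a N) (proj₁ facts)
      (subst (ℚ._≤ 1ℚ ℚ.+ δ) (seq-∑ (weight T) N) (proj₁ (proj₂ facts)))
      (subst (λ z → 1ℚ ℚ.≤ z ℚ.+ δ) (seq-∑ (weight T) N) (proj₁ (proj₂ (proj₂ facts))))

    accepts : ∀ i → (pos 2 ℚ./ 3) ℚ.≤ ∑ℚ (λ j → if accepting (x i) j then a N j else 0ℚ) ℚ.+ δ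
    accepts i = subst (λ z → (pos 2 ℚ./ 3) ℚ.≤ z ℚ.+ δ) (∑if (accepting (x i)) N)
      (proj₁ (proj₂ (proj₂ (proj₂ facts))) i)

    rejects : ∀ j → far j ≡ true →
      (pos 2 ℚ./ 3) ℚ.≤ ∑ℚ (λ k → if not (accepting (y j) k) then a N k else 0ℚ) ℚ.+ δ
    rejects j f = subst (λ z → (pos 2 ℚ./ 3) ℚ.≤ z ℚ.+ δ) (∑if-not (accepting (y j)) N)
      (proj₂ (proj₂ (proj₂ (proj₂ facts))) j f)

-- Parameters and conclusion

*-^-distrib : ∀ a b k → (a * b) ^ k ≡ a ^ k * b ^ k
*-^-distrib a b zero    = refl
*-^-distrib a b (suc k) = trans (cong (a * b *_) (*-^-distrib a b k))
  (solve 4 (λ a b x y → a :* b :* (x :* y) := a :* x :* (b :* y)) refl a b (a ^ k) (b ^ k))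

n≤2^n : ∀ n → n ≤ 2 ^ n
n≤2^n zero    = z≤n
n≤2^n (suc n) = begin
  1 + n               ≤⟨ +-mono-≤ (m^n>0 2 n) (n≤2^n n) ⟩
  2 ^ n + 2 ^ n       ≡⟨ cong (2 ^ n +_) (+-identityʳ (2 ^ n)) ⟨
  2 ^ suc n           ∎
  where open ≤-Reasoning

-- (1 + 1/64)³² < 2
65^32≤2*64^32 : 65 ^ 32 ≤ 2 * 64 ^ 32
65^32≤2*64^32 = ≤ᵇ⇒≤ (65 ^ 32) (2 * 64 ^ 32) _

abstract
  -- The base E for `c = suc (m + m)`: the growth factor E + c is then (1+1/64)E, and 32 letters
  -- lose at most a factor of 2.
  scale : ℕ → ℕ
  scale c = 64 * c

  scale-def : ∀ c → scale c ≡ 64 * c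
  scale-def c = refl

growth : ∀ c → (scale c + c) ^ 32 ≤ 2 * scale c ^ 32
growth c rewrite scale-def c = begin
  (64 * c + c) ^ 32          ≡⟨ cong (_^ 32) (+-comm (64 * c) c) ⟩
  (65 * c) ^ 32              ≡⟨ *-^-distrib 65 c 32 ⟩
  65 ^ 32 * c ^ 32           ≤⟨ *-monoˡ-≤ (c ^ 32) 65^32≤2*64^32 ⟩
  2 * 64 ^ 32 * c ^ 32       ≡⟨ *-assoc 2 (64 ^ 32) (c ^ 32) ⟩
  2 * (64 ^ 32 * c ^ 32)     ≡⟨ cong (2 *_) (*-^-distrib 64 c 32) ⟨
  2 * (64 * c) ^ 32          ∎
  where open ≤-Reasoning

-- The ratio of the two bases is at least 1, so the exponent may be rounded up to a multiple of 32.
power-ratio : ∀ c n t → n ≤ 32 * t → .{{_ : NonZero c}} →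
  (scale c + c) ^ n ≤ 2 ^ t * scale c ^ n
power-ratio c n t n≤ = *-cancelʳ-≤ _ _ (E ^ d) {{m^n≢0 E d {{E≢0}}}} (begin
  G ^ n * E ^ d             ≤⟨ *-monoʳ-≤ (G ^ n) (^-monoˡ-≤ d (m≤m+n E c)) ⟩
  G ^ n * G ^ d             ≡⟨ ^-distribˡ-+-* G n d ⟨
  G ^ (n + d)               ≡⟨ cong (G ^_) (m+[n∸m]≡n n≤) ⟩
  G ^ (32 * t)              ≡⟨ ^-*-assoc G 32 t ⟨
  (G ^ 32) ^ t              ≤⟨ ^-monoˡ-≤ t (growth c) ⟩
  (2 * E ^ 32) ^ t          ≡⟨ *-^-distrib 2 (E ^ 32) t ⟩
  2 ^ t * (E ^ 32) ^ t      ≡⟨ cong (2 ^ t *_) (^-*-assoc E 32 t) ⟩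
  2 ^ t * E ^ (32 * t)      ≡⟨ cong (λ k → 2 ^ t * E ^ k) (m+[n∸m]≡n n≤) ⟨
  2 ^ t * E ^ (n + d)       ≡⟨ cong (2 ^ t *_) (^-distribˡ-+-* E n d) ⟩
  2 ^ t * (E ^ n * E ^ d)   ≡⟨ *-assoc (2 ^ t) (E ^ n) (E ^ d) ⟨
  2 ^ t * E ^ n * E ^ d     ∎)
  where
  open ≤-Reasoning
  E = scale c
  G = E + c
  d = 32 * t ∸ n
  E≢0 : NonZero E
  E≢0 = subst NonZero (sym (scale-def c)) (m*n≢0 64 c)

reciprocal : ℕ → ℚ
reciprocal d = pos 1 ℚ./ suc d

0<reciprocal : ∀ d → 0ℚ ℚ.< reciprocal d
0<reciprocal d = ℚ.positive⁻¹ _ {{ℚ.normalize-pos 1 (suc d)}}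

close⇒≤ : ∀ {m n} d (x y : Vec (Paren m) n) → Close (reciprocal d) x y → suc d * hamming x y ≤ n
close⇒≤ {n = n} d x y close with ℚᵘ.≤-respˡ-≃ (ℚ.toℚᵘ-fromℚᵘ (mkℚᵘ (pos h) 0))
  (ℚᵘ.≤-respʳ-≃ (ℚᵘ.≃-trans (ℚ.toℚᵘ-homo-* (reciprocal d) (pos n ℚ./ 1))
      (ℚᵘ.*-cong (ℚ.toℚᵘ-fromℚᵘ (mkℚᵘ (pos 1) d)) (ℚ.toℚᵘ-fromℚᵘ (mkℚᵘ (pos n) 0))))
    (ℚ.toℚᵘ-mono-≤ close))
  where h = hamming x y
... | *≤* le = ℤ.drop‿+≤+ (subst₂ ℤ._≤_
  (trans (cong (λ z → pos h ℤ.* pos z) (*-identityʳ (suc d)))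
    (trans (sym (ℤ.pos-* h (suc d))) (cong pos (*-comm h (suc d)))))
  (trans (ℤ.*-identityʳ _) (ℤ.*-identityˡ (pos n))) le)
  where h = hamming x y

-- The origin of ε = 1/(32E): a Dyck word within distance h ≤ εn has Eh ≤ n/32, hence Eh ≤ s, and E
-- ≤ 2^E turns its factor E^h into at most 2^s. By `score≥` the score would then be too large.
far-from-Dyck : ∀ {m n} E s d (x : Vec (Paren m) n) → 1 ≤ E → suc d ≡ 32 * E → n < 32 * suc s →
  score E [] x * 2 ^ s < E ^ n → ∀ y → DyckWord m y → Far (reciprocal d) x y
far-from-Dyck {n = n} E s d x 1≤E d≡ n< small y dyck close = <⇒≱ small (begin
  E ^ n                               ≤⟨ score≥ E [] x y reduces ⟩
  score E [] x * E ^ h                ≤⟨ *-monoʳ-≤ (score E [] x) (begin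
    E ^ h           ≤⟨ ^-monoˡ-≤ h (n≤2^n E) ⟩
    (2 ^ E) ^ h     ≡⟨ ^-*-assoc 2 E h ⟩
    2 ^ (E * h)     ≤⟨ ^-monoʳ-≤ 2 Eh≤s ⟩
    2 ^ s           ∎) ⟩
  score E [] x * 2 ^ s                ∎)
  where
  open ≤-Reasoning
  h = hamming x y
  reduces : Reduces [] (toList y)
  reduces = subst (Reduces []) (++-identityʳ (toList y)) (Dyck⇒Reduces {st = []} dyck _)
  Eh≤s : E * h ≤ s
  Eh≤s = ≤-pred (*-cancelˡ-< 32 _ _ (≤-<-trans
    (≤-trans (≤-reflexive (trans (sym (*-assoc 32 E h)) (cong (_* h) (sym d≡)))) (close⇒≤ d x y close))
    n<))

-- Averaging over random inputs

weighted-total : ∀ {A k} (S : Summation A) (ω : Fin k → ℕ) (f : Fin k → A → ℕ) →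
  total S (λ a → ∑ᶠ λ i → ω i * f i a) ≡ ∑ᶠ λ i → ω i * total S (f i)
weighted-total {k = k} S ω f = trans (total-∑ᶠ S λ i a → ω i * f i a)
  (total-cong (finSum k) λ i → total-*ˡ S (ω i) (f i))

∑-𝟙-not : ∀ {k} (ω : Fin k → ℕ) (c : Fin k → Bool) →
  ∑ᶠ (λ i → ω i * 𝟙 (c i)) + ∑ᶠ (λ i → ω i * 𝟙 (not (c i))) ≡ ∑ᶠ ω
∑-𝟙-not {k} ω c = trans (sym (total-+ (finSum k) _ _)) (total-cong (finSum k) pointwise)
  where
  pointwise : ∀ i → ω i * 𝟙 (c i) + ω i * 𝟙 (not (c i)) ≡ ω i
  pointwise i with c i
  ... | true  = trans (cong₂ _+_ (*-identityʳ (ω i)) (*-zeroʳ (ω i))) (+-identityʳ (ω i))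
  ... | false = trans (cong (_+ ω i * 1) (*-zeroʳ (ω i))) (*-identityʳ (ω i))

∑-𝟙≤ : ∀ {k} (ω : Fin k → ℕ) (c : Fin k → Bool) → ∑ᶠ (λ i → ω i * 𝟙 (c i)) ≤ ∑ᶠ ω
∑-𝟙≤ {k} ω c = total-mono (finSum k) λ i →
  ≤-trans (*-monoʳ-≤ (ω i) (𝟙≤1 (c i))) (≤-reflexive (*-identityʳ (ω i)))

-- The easy half of Yao's principle, in sixteenths: the first family is accepted with probability at
-- least 10/16, the second with at most 6/16 plus 1/16 for inputs that are not far, and a gap of
-- 1/16 brings the first to at most 8/16.
distinguishing-gap : ∀ {I k} (S : Summation I) (ω : Fin k → ℕ)
  (accX accY : Fin k → I → Bool) (far : I → Bool) (B : ℕ) →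
  0 < ∑ᶠ ω → 0 < mass S →
  (∀ i → 5 * ∑ᶠ ω ≤ 8 * ∑ᶠ (λ k → ω k * 𝟙 (accX k i))) →
  (∀ i → far i ≡ true → 5 * ∑ᶠ ω ≤ 8 * ∑ᶠ (λ k → ω k * 𝟙 (not (accY k i)))) →
  16 * total S (λ i → 𝟙 (not (far i))) ≤ mass S →
  16 * B ≤ mass S →
  ¬ (∀ k → total S (λ i → 𝟙 (accX k i)) ≤ total S (λ i → 𝟙 (accY k i)) + B)
distinguishing-gap {I} {k} S ω accX accY far B Ω>0 mass>0 x-maj y-maj near≤ B≤ gap =
  <⇒≱ (*-monoˡ-< (Ω * T) {{m*n≢0 Ω T {{>-nonZero Ω>0}} {{>-nonZero mass>0}}}} (from-yes (8 <? 10))) (begin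
    10 * (Ω * T)
      ≡⟨ solve 2 (λ o t → con 10 :* (o :* t) := con 2 :* (con 5 :* o :* t)) refl Ω T ⟩
    2 * (5 * Ω * T)
      ≤⟨ *-monoʳ-≤ 2 x-total ⟩
    2 * (8 * ∑ᶠ (λ j → ω j * X j))
      ≤⟨ *-monoʳ-≤ 2 (*-monoʳ-≤ 8 (total-mono (finSum k) λ j → *-monoʳ-≤ (ω j) (gap j))) ⟩
    2 * (8 * ∑ᶠ (λ j → ω j * (Y j + B)))
      ≡⟨ cong (λ z → 2 * (8 * z)) split ⟩
    2 * (8 * (∑ᶠ (λ j → ω j * Y j) + Ω * B))
      ≡⟨ solve 3 (λ y o b → con 2 :* (con 8 :* (y :+ o :* b)) :=
                            con 2 :* (con 8 :* y) :+ o :* (con 16 :* b)) refl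
           (∑ᶠ (λ j → ω j * Y j)) Ω B ⟩
    2 * (8 * ∑ᶠ (λ j → ω j * Y j)) + Ω * (16 * B)
      ≤⟨ +-mono-≤ (*-monoʳ-≤ 2 y-total) (*-monoʳ-≤ Ω B≤) ⟩
    2 * (3 * Ω * T + 8 * Ω * Near) + Ω * T
      ≡⟨ solve 3 (λ o t n → con 2 :* (con 3 :* o :* t :+ con 8 :* o :* n) :+ o :* t
           := con 7 :* (o :* t) :+ o :* (con 16 :* n)) refl Ω T Near ⟩
    7 * (Ω * T) + Ω * (16 * Near)
      ≤⟨ +-monoʳ-≤ (7 * (Ω * T)) (*-monoʳ-≤ Ω near≤) ⟩
    7 * (Ω * T) + Ω * T
      ≡⟨ +-comm (7 * (Ω * T)) (Ω * T) ⟩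
    8 * (Ω * T) ∎)
  where
  open ≤-Reasoning
  Ω = ∑ᶠ ω
  T = mass S
  Near = total S (λ i → 𝟙 (not (far i)))
  X Y : Fin k → ℕ
  X j = total S (λ i → 𝟙 (accX j i))
  Y j = total S (λ i → 𝟙 (accY j i))

  split : ∑ᶠ (λ j → ω j * (Y j + B)) ≡ ∑ᶠ (λ j → ω j * Y j) + Ω * B
  split = trans (total-cong (finSum k) λ j → *-distribˡ-+ (ω j) (Y j) B)
    (trans (total-+ (finSum k) _ _) (cong (∑ᶠ (λ j → ω j * Y j) +_) (total-*ʳ (finSum k) ω B)))

  x-total : 5 * Ω * T ≤ 8 * ∑ᶠ (λ j → ω j * X j)
  x-total = begin
    5 * Ω * T                                                 ≡⟨ total-const S (5 * Ω) ⟨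
    total S (λ _ → 5 * Ω)                                     ≤⟨ total-mono S x-maj ⟩
    total S (λ i → 8 * ∑ᶠ (λ j → ω j * 𝟙 (accX j i)))         ≡⟨ total-*ˡ S 8 _ ⟩
    8 * total S (λ i → ∑ᶠ (λ j → ω j * 𝟙 (accX j i)))         ≡⟨ cong (8 *_)
                                                                   (weighted-total S ω λ j i → 𝟙 (accX j i)) ⟩
    8 * ∑ᶠ (λ j → ω j * X j)                                  ∎

  y-bound : ∀ i → 8 * ∑ᶠ (λ j → ω j * 𝟙 (accY j i)) ≤ 3 * Ω + 8 * Ω * 𝟙 (not (far i))
  y-bound i with far i in eq
  ... | false = begin
    8 * ∑ᶠ (λ j → ω j * 𝟙 (accY j i))   ≤⟨ *-monoʳ-≤ 8 (∑-𝟙≤ ω (λ j → accY j i)) ⟩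
    8 * Ω                               ≡⟨ *-identityʳ (8 * Ω) ⟨
    8 * Ω * 1                           ≤⟨ m≤n+m _ (3 * Ω) ⟩
    3 * Ω + 8 * Ω * 1                   ∎
  ... | true  = +-cancelˡ-≤ (5 * Ω) _ _ (begin
    5 * Ω + 8 * P
      ≤⟨ +-monoˡ-≤ (8 * P) (y-maj i eq) ⟩
    8 * P′ + 8 * P
      ≡⟨ solve 2 (λ p q → con 8 :* q :+ con 8 :* p := con 8 :* (p :+ q)) refl P P′ ⟩
    8 * (P + P′)
      ≡⟨ cong (8 *_) (∑-𝟙-not ω (λ j → accY j i)) ⟩
    8 * Ω
      ≡⟨ solve 1 (λ o → con 8 :* o := con 5 :* o :+ (con 3 :* o :+ con 8 :* o :* con 0)) refl Ω ⟩
    5 * Ω + (3 * Ω + 8 * Ω * 0) ∎)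
    where
    P P′ : ℕ
    P  = ∑ᶠ (λ j → ω j * 𝟙 (accY j i))
    P′ = ∑ᶠ (λ j → ω j * 𝟙 (not (accY j i)))

  y-total : 8 * ∑ᶠ (λ j → ω j * Y j) ≤ 3 * Ω * T + 8 * Ω * Near
  y-total = begin
    8 * ∑ᶠ (λ j → ω j * Y j)
      ≡⟨ cong (8 *_) (weighted-total S ω λ j i → 𝟙 (accY j i)) ⟨
    8 * total S (λ i → ∑ᶠ (λ j → ω j * 𝟙 (accY j i)))
      ≡⟨ total-*ˡ S 8 _ ⟨
    total S (λ i → 8 * ∑ᶠ (λ j → ω j * 𝟙 (accY j i)))
      ≤⟨ total-mono S y-bound ⟩
    total S (λ i → 3 * Ω + 8 * Ω * 𝟙 (not (far i)))
      ≡⟨ total-+ S _ _ ⟩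
    total S (λ _ → 3 * Ω) + total S (λ i → 8 * Ω * 𝟙 (not (far i)))
      ≡⟨ cong₂ _+_ (total-const S (3 * Ω)) (total-*ˡ S (8 * Ω) _) ⟩
    3 * Ω * T + 8 * Ω * Near ∎

𝟙-not-< : ∀ {a b} (a<?b : Dec (a < b)) → 𝟙 (not (does a<?b)) * b ≤ a
𝟙-not-< (yes _)   = z≤n
𝟙-not-< (no  a≮b) = ≤-trans (≤-reflexive (+-identityʳ _)) (≮⇒≥ a≮b)

module _ {m : ℕ} {t₀ t₁ : Fin m} (t₀≢t₁ : t₀ ≢ t₁) (L R′ M : ℕ) where

  open Layout t₀ t₁ L R′ M

  private
    c E : ℕ
    c = suc (m + m)
    E = scale c

    1≤E : 1 ≤ E
    1≤E = subst (1 ≤_) (sym (scale-def c)) (s≤s z≤n)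

    samples : Summation (Θ × Vec Bool n)
    samples = shapes ⊗ bitSum n

    mass-samples : mass samples ≡ L * R * 2 ^ n
    mass-samples = trans (mass-⊗ shapes (bitSum n)) (cong₂ _*_
      (trans (mass-⊗ (finSum L) (finSum R)) (cong₂ _*_ (mass-finSum L) (mass-finSum R)))
      (mass-bitSum n))

    score-of : Θ × Vec Bool n → ℕ
    score-of (θ , w) = score E [] (word (independent θ) w)

    scores-total : 2 ^ M * total samples score-of ≤ 2 ^ n * (E + c) ^ n * (L * R)
    scores-total = begin
      2 ^ M * total samples score-of
        ≡⟨ total-*ˡ shapes (2 ^ M) (λ θ → ∑ᵇ (λ w → score-of (θ , w))) ⟨
      total shapes (λ θ → 2 ^ M * ∑ᵇ (λ w → score-of (θ , w)))
        ≤⟨ total-mono shapes (independent-score 1≤E t₀≢t₁) ⟩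
      total shapes (λ _ → 2 ^ n * (E + c) ^ n)
        ≡⟨ total-const shapes (2 ^ n * (E + c) ^ n) ⟩
      2 ^ n * (E + c) ^ n * mass shapes
        ≡⟨ cong (2 ^ n * (E + c) ^ n *_)
             (trans (mass-⊗ (finSum L) (finSum R)) (cong₂ _*_ (mass-finSum L) (mass-finSum R))) ⟩
      2 ^ n * (E + c) ^ n * (L * R) ∎
      where open ≤-Reasoning

    -- A decidable certificate: `far-from-Dyck` converts a small score into distance from every Dyck
    -- word.
    far : ℕ → Θ × Vec Bool n → Bool
    far s i = does (score-of i * 2 ^ s <? E ^ n)

    -- Markov's inequality for the score at E^n / 2^s. The mean is at most 2^(-M) (E+c)^n ≤
    -- 2^(s+1-M) E^n, so the probability is at most 2^(2s+1-M), and the 4 in the hypothesis makes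
    -- that 1/16.
    near-total : ∀ s → n ≤ 32 * suc s → s + suc s + 4 ≤ M →
      16 * total samples (λ i → 𝟙 (not (far s i))) ≤ mass samples
    near-total s n≤ ≤M = *-cancelʳ-≤ _ _ (2 ^ (s + suc s)) {{m^n≢0 2 (s + suc s)}}
      (*-cancelʳ-≤ _ _ (E ^ n) {{m^n≢0 E n {{>-nonZero 1≤E}}}} (begin
      16 * Near * 2 ^ (s + suc s) * E ^ n
        ≡⟨ solve 3 (λ a b e → con 16 :* a :* b :* e := b :* con 16 :* (a :* e)) refl
             Near (2 ^ (s + suc s)) (E ^ n) ⟩
      2 ^ (s + suc s) * 2 ^ 4 * (Near * E ^ n)
        ≡⟨ cong (_* (Near * E ^ n)) (^-distribˡ-+-* 2 (s + suc s) 4) ⟨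
      2 ^ (s + suc s + 4) * (Near * E ^ n)
        ≤⟨ *-mono-≤ (^-monoʳ-≤ 2 ≤M) near-scores ⟩
      2 ^ M * (total samples score-of * 2 ^ s)
        ≡⟨ *-assoc (2 ^ M) (total samples score-of) (2 ^ s) ⟨
      2 ^ M * total samples score-of * 2 ^ s
        ≤⟨ *-monoˡ-≤ (2 ^ s) scores-total ⟩
      2 ^ n * (E + c) ^ n * (L * R) * 2 ^ s
        ≤⟨ *-monoˡ-≤ (2 ^ s) (*-monoˡ-≤ (L * R) (*-monoʳ-≤ (2 ^ n) (power-ratio c n (suc s) n≤))) ⟩
      2 ^ n * (2 ^ suc s * E ^ n) * (L * R) * 2 ^ s
        ≡⟨ solve 5 (λ a b e l d → a :* (b :* e) :* l :* d := l :* a :* (d :* b) :* e) refl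
             (2 ^ n) (2 ^ suc s) (E ^ n) (L * R) (2 ^ s) ⟩
      L * R * 2 ^ n * (2 ^ s * 2 ^ suc s) * E ^ n
        ≡⟨ cong₂ (λ x y → x * y * E ^ n) mass-samples (^-distribˡ-+-* 2 s (suc s)) ⟨
      mass samples * 2 ^ (s + suc s) * E ^ n ∎))
      where
      open ≤-Reasoning
      Near = total samples (λ i → 𝟙 (not (far s i)))

      near-score : ∀ i → 𝟙 (not (far s i)) * E ^ n ≤ score-of i * 2 ^ s
      near-score i = 𝟙-not-< (score-of i * 2 ^ s <? E ^ n)

      near-scores : Near * E ^ n ≤ total samples score-of * 2 ^ s
      near-scores = begin
        Near * E ^ n                                          ≡⟨ total-*ʳ samples (λ i → 𝟙 (not (far s i))) (E ^ n) ⟨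
        total samples (λ i → 𝟙 (not (far s i)) * E ^ n)       ≤⟨ total-mono samples near-score ⟩
        total samples (λ i → score-of i * 2 ^ s)              ≡⟨ total-*ʳ samples score-of (2 ^ s) ⟩
        total samples score-of * 2 ^ s                        ∎

  -- The inequality with 32 says that the gap 2q(R + Lq), out of L R shapes, is at most 1/16.
  no-tester : ∀ {q} s d (T : RandomizedAlgorithm (Paren m) n q) → 0 < L →
    32 * (q * (R + L * q)) ≤ L * R →
    suc d ≡ 32 * E → n < 32 * suc s → s + suc s + 4 ≤ M →
    ¬ IsTester (reciprocal d) (DyckWord m) T
  no-tester {q} s d T 0<L few d≡ n< ≤M tester =
    distinguishing-gap samples ω
      (λ k i → accepting T (yes-word i) k) (λ k i → accepting T (no-word i) k)
      (far s) (2 ^ n * (2 * (q * (R + L * q))))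
      (proj₁ (proj₂ weights))
      (subst (0 <_) (sym mass-samples) (*-mono-≤ (*-mono-≤ 0<L (s≤s z≤n)) (m^n>0 2 n)))
      (proj₁ (proj₂ (proj₂ weights))) (proj₂ (proj₂ (proj₂ weights)))
      (near-total s (<⇒≤ n<) ≤M)
      gap≤
      (λ k → acceptances-close shapes balanced independent balanced-deviation independent-deviation
        (hides-total ∘ place) (λ p p′ → matched-total (place p) (place p′)) (algorithm T k))
    where
    yes-word no-word : Θ × Vec Bool n → Vec (Paren m) n
    yes-word (θ , w) = word (balanced θ) w
    no-word  (θ , w) = word (independent θ) w

    enum : Enumerable (Θ × Vec Bool n)
    enum = enum-× (enum-× ev-Fin ev-Fin) ev-Bits

    weights = natural-weights T enum enum
      yes-word (λ (θ , w) → IsTester.accepts tester (word (balanced θ) w) (balanced-Dyck θ w))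
      no-word (far s) (λ i eq → IsTester.rejects tester (no-word i)
        (far-from-Dyck E s d (no-word i) 1≤E d≡ n< (does⇒holds (score-of i * 2 ^ s <? E ^ n) eq)))

    ω = proj₁ weights

    gap≤ : 16 * (2 ^ n * (2 * (q * (R + L * q)))) ≤ mass samples
    gap≤ = begin
      16 * (2 ^ n * (2 * (q * (R + L * q))))
        ≡⟨ solve 2 (λ t b → con 16 :* (t :* (con 2 :* b)) := con 32 :* b :* t) refl (2 ^ n) (q * (R + L * q)) ⟩
      32 * (q * (R + L * q)) * 2 ^ n
        ≤⟨ *-monoˡ-≤ (2 ^ n) few ⟩
      L * R * 2 ^ n
        ≡⟨ mass-samples ⟨
      mass samples ∎
      where open ≤-Reasoning

-- The passage from the fifth power to the cubic length of the construction: for q ≥ 1 the left side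
-- is at most 2^18 q^3, and (16q)^5 = 2^20 q^5. For q = 0 the threshold 32768 is itself the required
-- length.
cube-bound : ∀ q n → 32768 ≤ n → (16 * q) ^ 5 < n → 32768 * (suc q * (suc q * suc q)) ≤ n
cube-bound zero      n big _     = big
cube-bound q@(suc p) n _   large = begin
  32768 * (suc q * (suc q * suc q))
    ≤⟨ *-monoʳ-≤ 32768 (*-mono-≤ Q≤ (*-mono-≤ Q≤ Q≤)) ⟩
  32768 * (2 * q * (2 * q * (2 * q)))
    ≡⟨ solve 1 (λ q → con 32768 :* (con 2 :* q :* (con 2 :* q :* (con 2 :* q))) :=
         con 262144 :* (q :* (q :* q))) refl q ⟩
  262144 * (q * (q * q))
    ≤⟨ *-mono-≤ (≤ᵇ⇒≤ 262144 1048576 _)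
         (*-monoʳ-≤ q (*-monoʳ-≤ q (m≤m*n q (q * q)))) ⟩
  1048576 * (q * (q * (q * (q * q))))
    ≡⟨ solve 1 (λ q → con 1048576 :* (q :* (q :* (q :* (q :* q)))) := (con 16 :* q) :^ 5) refl q ⟩
  (16 * q) ^ 5
    ≤⟨ <⇒≤ large ⟩
  n ∎
  where
  open ≤-Reasoning
  Q≤ : suc q ≤ 2 * q
  Q≤ = +-mono-≤ (s≤s z≤n) (≤-reflexive (sym (+-identityʳ q)))

module Parameters (q h : ℕ) (room : 32768 * (suc q * (suc q * suc q)) ≤ h * 2) where

  -- With R = 64Q² the product L R is `Z`, and half the length is R + 2 L R + M, so `X` is what
  -- remains beside `M`. As X ≤ 3Z and 4Z ≤ h, the run takes at least a quarter of `h`. Using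
  -- `suc q` for `Q` keeps L and R positive.
  Q L R′ Z X M : ℕ
  Q  = suc q
  L  = 64 * Q
  R′ = pred (64 * (Q * Q))
  Z  = 4096 * (Q * (Q * Q))
  X  = 64 * (Q * Q) + 2 * Z
  M  = h ∸ X

  private
    open ≤-Reasoning

    LR≡Z : L * (64 * (Q * Q)) ≡ Z
    LR≡Z = solve 1 (λ q → con 64 :* q :* (con 64 :* (q :* q)) := con 4096 :* (q :* (q :* q))) refl Q

    4Z≤h : 4 * Z ≤ h
    4Z≤h = *-cancelʳ-≤ _ _ 2 (≤-trans (≤-reflexive
      (solve 1 (λ q → con 4 :* (con 4096 :* q) :* con 2 := con 32768 :* q) refl (Q * (Q * Q)))) room)

    X≤3Z : X ≤ 3 * Z
    X≤3Z = ≤-trans (+-monoˡ-≤ (2 * Z) (*-mono-≤ (≤ᵇ⇒≤ 64 4096 _) (m≤n*m (Q * Q) Q)))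
      (≤-reflexive (solve 1 (λ z → z :+ con 2 :* z := con 3 :* z) refl Z))

    X≤h : X ≤ h
    X≤h = ≤-trans X≤3Z (≤-trans (*-monoˡ-≤ Z (≤ᵇ⇒≤ 3 4 _)) 4Z≤h)

    h≡X+M : X + M ≡ h
    h≡X+M = m+[n∸m]≡n X≤h

    Z≤M : Z ≤ M
    Z≤M = +-cancelˡ-≤ (3 * Z) _ _ (begin
      3 * Z + Z  ≡⟨ solve 1 (λ z → con 3 :* z :+ z := con 4 :* z) refl Z ⟩
      4 * Z      ≤⟨ 4Z≤h ⟩
      h          ≡⟨ h≡X+M ⟨
      X + M      ≤⟨ +-monoˡ-≤ M X≤3Z ⟩
      3 * Z + M  ∎)

    n≤8M : h * 2 ≤ 8 * M
    n≤8M = begin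
      h * 2                ≡⟨ cong (_* 2) h≡X+M ⟨
      (X + M) * 2          ≤⟨ *-monoˡ-≤ 2 (+-monoˡ-≤ M (≤-trans X≤3Z (*-monoʳ-≤ 3 Z≤M))) ⟩
      (3 * M + M) * 2      ≡⟨ solve 1 (λ m → (con 3 :* m :+ m) :* con 2 := con 8 :* m) refl M ⟩
      8 * M                ∎

  length≡ : ∀ {m} (t₀ t₁ : Fin m) → h * 2 ≡ Layout.n t₀ t₁ L R′ M
  length≡ t₀ t₁ = trans (cong (_* 2) (sym h≡X+M))
    (trans (cong (λ z → (64 * (Q * Q) + 2 * z + M) * 2) (sym LR≡Z))
      (solve 3 (λ l r m → (r :+ con 2 :* (l :* r) :+ m) :* con 2 :=
                          r :* con 2 :+ m :+ (l :* (r :* con 2) :+ (m :+ l :* (r :* con 2)))) refl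
        L (64 * (Q * Q)) M))

  few-queries : 32 * (q * (suc R′ + L * q)) ≤ L * suc R′
  few-queries = begin
    32 * (q * (64 * (Q * Q) + L * q))
      ≤⟨ *-monoʳ-≤ 32 (*-mono-≤ (n≤1+n q) (+-monoʳ-≤ (64 * (Q * Q)) (*-monoʳ-≤ L (n≤1+n q)))) ⟩
    32 * (Q * (64 * (Q * Q) + L * Q))
      ≡⟨ solve 1 (λ q → con 32 :* (q :* (con 64 :* (q :* q) :+ con 64 :* q :* q)) :=
                        con 64 :* q :* (con 64 :* (q :* q))) refl Q ⟩
    L * (64 * (Q * Q)) ∎

  s : ℕ
  s = h * 2 / 32

  s-large : h * 2 < 32 * suc s
  s-large = begin-strict
    h * 2                          ≡⟨ m≡m%n+[m/n]*n (h * 2) 32 ⟩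
    h * 2 % 32 + s * 32            <⟨ +-monoˡ-< (s * 32) (m%n<n (h * 2) 32) ⟩
    32 + s * 32                    ≡⟨ *-comm (suc s) 32 ⟩
    32 * suc s                     ∎

  -- With n = 2h, 2s is at most n/16 while M is at least n/8; the difference n/16 covers the
  -- remaining 5 once n ≥ 80.
  s-small : s + suc s + 4 ≤ M
  s-small = *-cancelˡ-≤ 16 (begin
    16 * (s + suc s + 4)
      ≡⟨ solve 1 (λ s → con 16 :* (s :+ (con 1 :+ s) :+ con 4) := s :* con 32 :+ con 80) refl s ⟩
    s * 32 + 80          ≤⟨ +-mono-≤ (m/n*n≤m (h * 2) 32) 80≤n ⟩
    h * 2 + h * 2        ≤⟨ +-mono-≤ n≤8M n≤8M ⟩
    8 * M + 8 * M        ≡⟨ solve 1 (λ m → con 8 :* m :+ con 8 :* m := con 16 :* m) refl M ⟩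
    16 * M               ∎)
    where
    80≤n : 80 ≤ h * 2
    80≤n = ≤-trans (*-mono-≤ (≤ᵇ⇒≤ 80 32768 _) (s≤s z≤n)) room

corollary5p2 : ∀ (m : ℕ) → 2 ≤ m →
    ∃[ ε ] (0ℚ ℚ.< ε ×
    (∃[ C ] ∃[ n₀ ] (∀ (n : ℕ) → n₀ ≤ n → 2 ∣ n →
    ∀ (q : ℕ) (T : RandomizedAlgorithm (Paren m) n q) →
    IsTester ε (DyckWord m) T →
    FifthRootBound C n q)))
corollary5p2 (suc zero)      (s≤s ())
-- The constants 16 and 32768 are those of `cube-bound`; ε is 1/(32E), with E depending on `m`
-- alone.
corollary5p2 m@(suc (suc _)) _ = reciprocal d , 0<reciprocal d , 16 , 32768 , bound
  where
  E d : ℕ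
  E = scale (suc (m + m))
  d = pred (32 * E)

  d≡ : suc d ≡ 32 * E
  d≡ = suc-pred (32 * E) {{m*n≢0 32 E {{_}} {{nz}}}}
    where
    nz : NonZero E
    nz = subst NonZero (sym (scale-def (suc (m + m)))) _

  no-short-tester : ∀ {n} q h → n ≡ h * 2 → 32768 * (suc q * (suc q * suc q)) ≤ n →
    (T : RandomizedAlgorithm (Paren m) n q) → ¬ IsTester (reciprocal d) (DyckWord m) T
  no-short-tester q h refl room = at-length (P.length≡ t₀ t₁) P.s-large
    where
    module P = Parameters q h room
    t₀ t₁ : Fin m
    t₀ = zero
    t₁ = suc zero
    at-length : ∀ {n} → n ≡ Layout.n t₀ t₁ P.L P.R′ P.M → n < 32 * suc P.s →
      (T : RandomizedAlgorithm (Paren m) n q) → ¬ IsTester (reciprocal d) (DyckWord m) T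
    at-length refl n< T =
      no-tester {t₀ = t₀} {t₁} (λ ()) P.L P.R′ P.M P.s d T (s≤s z≤n) P.few-queries d≡ n< P.s-small

  bound : ∀ n → 32768 ≤ n → 2 ∣ n → ∀ q (T : RandomizedAlgorithm (Paren m) n q) →
    IsTester (reciprocal d) (DyckWord m) T → FifthRootBound 16 n q
  bound n big (divides h n≡) q T tester = [ id , (λ large → contradiction tester
    (no-short-tester q h n≡ (cube-bound q n big large) T)) ]′ (≤-<-connex n ((16 * q) ^ 5))
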